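{- For a positive integer $t \geq 3$, let $G$ be a connected $K_{1,t}$-free graph and let $l$ be an integer with $l \neq t-2$. If $$\sigma^{4}_{l+1}(G)\geq |G|-\left\lfloor \frac{l(t-1)}{t-2}\right\rfloor-1,$$ then $G$ has a spanning tree with $l$-ended stem, i.e. a spanning tree $T$ of $G$ such that $Stem(T)$ has at most $l$ leaves.
   Context: All graphs are finite and simple. For a graph $G$ with vertex set $V(G)$, $|G|$ denotes the number of vertices of $G$, $\deg_G(v)$ the degree of $v$ in $G$, and $d_G(u,v)$ the distance between $u$ and $v$ in $G$. A graph is $K_{1,t}$-free if it contains no $K_{1,t}$ (star with $t$ leaves) as an induced subgraph. For an integer $m \geq 2$, let $$\alpha^{m}(G)=\max\{|S| : S\subseteq V(G),\ d_G(x,y)\geq m \text{ for all distinct } x,y\in S\}.$$ For integers $m \geq 2$ and $p\geq 2$, let $$\sigma^{m}_{p}(G)=\min\left\{\sum_{a\in S}\deg_G(a) : S\subseteq V(G),\ |S|=p,\ d_G(x,y)\geq m \text{ for all distinct } x,y\in S\right\},$$ with the convention $\sigma^m_p(G)=+\infty$ if $\alpha^m(G)<p$. For a tree $T$, a leaf is a vertex of degree one in $T$, and $Leaf(T)$ is the set of leaves of $T$. The stem of $T$ is the subtree $Stem(T)=T-Leaf(T)$ obtained by deleting all leaves of $T$. The leaves of $Stem(T)$ are the vertices of degree one in the tree $Stem(T)$. The stem is called $l$-ended if it has at most $l$ leaves. $\lfloor r\rfloor$ denotes the largest integer not exceeding the real number $r$.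
   Formalization: The formal theorem assumes l ≥ 2; the remaining admissible value l = 1 (with t ≥ 4) is false as stated: the path on four vertices has σ⁴_2 = +∞, but its only spanning tree has a stem with two leaves. -}

module Defs where

open import Data.Fin.Base using (Fin; zero; suc)
import Data.Fin.Properties as Fin
open import Data.Fin.Subset
  using (Subset; inside; outside; _∈_; _∉_; _⊆_; _∩_; _─_; ∣_∣; ⊤)
open import Data.Fin.Subset.Properties
  using (_∈?_; _⊆?_; ∈⊤; x∈p∧x∉q⇒x∈p─q)
open import Data.List.Base as List
  using (List; []; _∷_; _++_; allFin; filter; upTo)
open import Data.Nat.ListAction using (sum)
open import Data.List.Relation.Unary.Linked using (Linked)
open import Data.List.Relation.Unary.Unique.Propositional using (Unique)
open import Data.Nat.Base using (ℕ; zero; suc; _≤_; _<_; _∸_; NonZero; >-nonZero)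
open import Data.Nat.Properties using (_≟_; ≤-isTotalOrder; _≤?_; m<n⇒0<n∸m)
open import Data.Product.Base using (∃-syntax; _×_; _,_)
open import Data.Vec.Base as Vec using (tabulate)
open import Function.Bundles using (_⇔_)
open import Level using (0ℓ)
open import Relation.Binary.Bundles using (TotalOrder)
open import Relation.Binary.Core using (Rel)
import Relation.Binary.Definitions as B
import Relation.Binary.Construct.Add.Supremum.NonStrict as NonStrict
open import Relation.Binary.PropositionalEquality using (_≡_; _≢_)
open import Relation.Nullary using (¬_; yes; no; does; _×-dec_; _→-dec_; ¬?)
open import Relation.Nullary.Construct.Add.Supremum using (_⁺; [_]; ⊤⁺)
open import Relation.Unary using (Pred; Decidable)

ℕ∞ : Set
ℕ∞ = ℕ ⁺

open NonStrict _≤_ public using () renaming (_≤⁺_ to _≤∞_)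

≤∞-dec : B.Decidable _≤∞_
≤∞-dec = NonStrict.≤⁺-dec _≤_ _≤?_

≤∞-totalOrder : TotalOrder 0ℓ 0ℓ 0ℓ
≤∞-totalOrder = record { isTotalOrder = NonStrict.≤⁺-isTotalOrder-≡ _≤_ ≤-isTotalOrder }

open import Data.List.Extrema ≤∞-totalOrder using (min)

-- The minimum of the empty list is +∞.
minimum : List ℕ → ℕ∞
minimum xs = min ⊤⁺ (List.map [_] xs)

⟦_⟧ : ∀ {N} {P : Pred (Fin N) 0ℓ} → Decidable P → Subset N
⟦ P? ⟧ = tabulate λ v → does (P? v)

subsets : ∀ N → List (Subset N)
subsets zero    = Vec.[] ∷ []
subsets (suc N) = List.map (inside Vec.∷_) (subsets N) ++ List.map (outside Vec.∷_) (subsets N)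

-- A finite simple graph whose vertex set is an arbitrary subset of the
-- ambient set Fin N.  In this way a graph and its subgraphs have the same type.
record Graph (N : ℕ) : Set₁ where
  field
    V         : Subset N
    Adj       : Rel (Fin N) 0ℓ
    adj?      : B.Decidable Adj
    adj-sym   : B.Symmetric Adj
    adj-irr   : ∀ {v} → ¬ Adj v v
    adj⇒∈     : ∀ {u v} → Adj u v → u ∈ V

open Graph public

∥_∥ : ∀ {N} → Graph N → ℕ
∥ G ∥ = ∣ V G ∣

deg : ∀ {N} → Graph N → Fin N → ℕ
deg G v = ∣ ⟦ adj? G v ⟧ ∣

Walk : ∀ {N} → Graph N → ℕ → Rel (Fin N) 0ℓ
Walk G zero    u v = u ≡ v
Walk G (suc k) u v = ∃[ w ] Adj G u w × Walk G k w v

walk? : ∀ {N} (G : Graph N) k → B.Decidable (Walk G k)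
walk? G zero    u v = u Fin.≟ v
walk? G (suc k) u v = Fin.any? λ w → adj? G u w ×-dec walk? G k w v

-- The least length of a walk from u to v, and +∞ if there is none.  A shortest
-- walk repeats no vertex, so only the lengths 0 , … , N - 1 can occur.
dist : ∀ {N} → Graph N → Fin N → Fin N → ℕ∞
dist {N} G u v = minimum (filter (λ k → walk? G k u v) (upTo N))

Far : ∀ {N} → Graph N → ℕ → Subset N → Set
Far G m S = ∀ x y → x ∈ S → y ∈ S → x ≢ y → [ m ] ≤∞ dist G x y

far? : ∀ {N} (G : Graph N) m → Decidable (Far G m)
far? G m S = Fin.all? λ x → Fin.all? λ y →
  (x ∈? S) →-dec ((y ∈? S) →-dec (¬? (x Fin.≟ y) →-dec ≤∞-dec [ m ] (dist G x y)))

degSum : ∀ {N} → Graph N → Subset N → ℕ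
degSum {N} G S = sum (List.map (deg G) (filter (_∈? S) (allFin N)))

Admissible : ∀ {N} → ℕ → ℕ → Graph N → Pred (Subset N) 0ℓ
Admissible m p G S = S ⊆ V G × ∣ S ∣ ≡ p × Far G m S

admissible? : ∀ {N} m p (G : Graph N) → Decidable (Admissible m p G)
admissible? m p G S = (S ⊆? V G) ×-dec ((∣ S ∣ ≟ p) ×-dec far? G m S)

-- If no S is admissible, which is the case αᵐ(G) < p, the value is +∞.
σ : ∀ {N} → ℕ → ℕ → Graph N → ℕ∞
σ {N} m p G = minimum (List.map (degSum G) (filter (admissible? m p G) (subsets N)))

record InducedCopy {M N} (H : Graph M) (G : Graph N) : Set where
  field
    f     : Fin M → Fin N
    f-V   : ∀ {u} → u ∈ V H → f u ∈ V G
    f-inj : ∀ {u v} → u ∈ V H → v ∈ V H → f u ≡ f v → u ≡ v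
    f-adj : ∀ {u v} → u ∈ V H → v ∈ V H → Adj H u v ⇔ Adj G (f u) (f v)

data StarAdj {t} : Rel (Fin (suc t)) 0ℓ where
  out : ∀ {i} → StarAdj zero (suc i)
  inn : ∀ {i} → StarAdj (suc i) zero

starAdj? : ∀ {t} → B.Decidable (StarAdj {t})
starAdj? zero    zero    = no λ ()
starAdj? zero    (suc _) = yes out
starAdj? (suc _) zero    = yes inn
starAdj? (suc _) (suc _) = no λ ()

Star : ∀ t → Graph (suc t)
Star t = record
  { V       = ⊤
  ; Adj     = StarAdj
  ; adj?    = starAdj?
  ; adj-sym = λ { out → inn ; inn → out }
  ; adj-irr = λ ()
  ; adj⇒∈   = λ _ → ∈⊤
  }

StarFree : ∀ {N} → ℕ → Graph N → Set
StarFree t G = ¬ InducedCopy (Star t) G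

-- The graph without vertices does not count as connected.
Connected : ∀ {N} → Graph N → Set
Connected G = (∃[ v ] v ∈ V G) × (∀ {u v} → u ∈ V G → v ∈ V G → ∃[ k ] Walk G k u v)

-- The cycle x , y , z , … , x, where x , y , z , … are distinct.
record Cycle {N} (G : Graph N) : Set where
  field
    x y z : Fin N
    ws    : List (Fin N)
    uniq  : Unique (x ∷ y ∷ z ∷ ws)
    edges : Linked (Adj G) (x ∷ y ∷ z ∷ ws ++ x ∷ [])

IsTree : ∀ {N} → Graph N → Set
IsTree T = Connected T × ¬ Cycle T

IsSpanningTree : ∀ {N} → Graph N → Graph N → Set
IsSpanningTree T G = IsTree T × V T ≡ V G × (∀ {u v} → Adj T u v → Adj G u v)

_-ᵍ_ : ∀ {N} → Graph N → Subset N → Graph N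
G -ᵍ S = record
  { V       = V G ─ S
  ; Adj     = λ u v → Adj G u v × u ∉ S × v ∉ S
  ; adj?    = λ u v → adj? G u v ×-dec (¬? (u ∈? S) ×-dec ¬? (v ∈? S))
  ; adj-sym = λ { (e , u∉S , v∉S) → adj-sym G e , v∉S , u∉S }
  ; adj-irr = λ { (e , _) → adj-irr G e }
  ; adj⇒∈   = λ { (e , u∉S , _) → x∈p∧x∉q⇒x∈p─q (adj⇒∈ G e) u∉S }
  }

Leaf : ∀ {N} → Graph N → Subset N
Leaf G = V G ∩ ⟦ (λ v → deg G v ≟ 1) ⟧

-- For the tree on two vertices the stem has no vertices.
Stem : ∀ {N} → Graph N → Graph N
Stem T = T -ᵍ Leaf T

∸-nonZero : ∀ {m n} → m < n → NonZero (n ∸ m)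
∸-nonZero m<n = >-nonZero (m<n⇒0<n∸m m<n)

{-# OPTIONS --safe #-}

-- Let S be a subtree of G that dominates G.  Deleting leaves we may assume that
-- each leaf x of S has a private neighbour y outside S, one whose only neighbour
-- in S is x; then S together with pendant edges is a spanning tree whose stem has
-- no leaves but those of S.  So it suffices to lower the number m of leaves of S
-- while m > l.  If the private neighbours of two leaves x, x′ are at distance at
-- most 3, there is a path from x to x′ outside S: add it, and cut S just before the
-- first branching vertex met from x, which leaves m - 1 leaves.  Otherwise l + 1
-- private neighbours are admissible for σ⁴, their closed neighbourhoods miss the set
-- W of non-leaves of S, and the degree condition gives |W| (t - 2) ≤ l < m.  Hence
-- some w ∈ W is adjacent to at least t - 1 leaves of S.  If w has a neighbour a in S
-- that is not a leaf, then a is adjacent in G to one of these leaves x, as G is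
-- K(1,t)-free, and replacing the edge w a by x a leaves m - 1 leaves.  If not, S is
-- a star with m ≤ t - 1, and |W| = 1 forces l = t - 2.
module Submission where

open import Defs
open import Data.Empty using (⊥; ⊥-elim)
open import Data.Fin using (Fin; zero; suc; toℕ)
import Data.Fin as Fin using (inject≤; fromℕ<)
import Data.Fin.Properties as Fin
open import Data.Fin.Subset using (Subset; inside; outside; ∣_∣; _─_)
  renaming (_∈_ to _∈ˢ_; _∉_ to _∉ˢ_)
open import Data.Fin.Subset.Properties using (_∈?_; x∈p∩q⁺; x∈p∩q⁻; p─q⊆p)
open import Data.List.Base
  using (List; []; _∷_; _++_; length; map; filter; allFin; lookup; take; concatMap; upTo)
open import Data.List.Extrema ≤∞-totalOrder using (min≤xs; v≤min⁺)
import Data.List.Membership.DecPropositional as DecMembership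
open import Data.List.Membership.Propositional using (_∈_; _∉_; find; lose)
open import Data.List.Membership.Propositional.Properties
  using ( ∈-++⁺ˡ; ∈-++⁺ʳ; ∈-++⁻; ∈-∃++; ∈-filter⁺; ∈-filter⁻; ∈-allFin; ∈-map⁺; ∈-map⁻
        ; ∈-concatMap⁺; ∈-concatMap⁻; ∈-lookup; ∈-length)
open import Data.List.Properties
  using ( length-++; ++-assoc; ++-identityʳ; length-++-≤ˡ; length-map; length-tabulate
        ; length-take; take++drop≡id)
open import Data.List.Relation.Binary.Permutation.Propositional as Perm
  using (_↭_; ↭-refl; ↭-sym; ↭-trans; prep; swap; ↭⇒↭ₛ)
open import Data.List.Relation.Binary.Permutation.Propositional.Properties
  using (++-comm; ++⁺ˡ; shift; shifts; ∈-resp-↭; ↭-length)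
import Data.List.Relation.Binary.Permutation.Setoid.Properties as Permₛ
open import Data.List.Relation.Unary.All as All using ([]; _∷_)
import Data.List.Relation.Unary.All.Properties as All
open import Data.List.Relation.Unary.AllPairs as AllPairs using ([]; _∷_)
open import Data.List.Relation.Unary.Any as Any using (here; there)
open import Data.List.Relation.Unary.Linked as Linked using (Linked; [-]; _∷_)
open import Data.List.Relation.Unary.Unique.Propositional using (Unique)
open import Data.List.Relation.Unary.Unique.Propositional.Properties
  using (Unique[x∷xs]⇒x∉xs; allFin⁺; filter⁺; map⁺; take⁺) renaming (++⁺ to ++⁺-Unique)
open import Data.Nat
  using (ℕ; zero; suc; _≤_; _<_; z≤n; s≤s; _+_; _*_; _∸_; _/_; >-nonZero)
open import Data.Nat.DivMod using (m/n*n≤m)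
open import Data.Nat.ListAction using (sum)
open import Data.Nat.Properties as ℕ using (≤-refl; ≤-trans; ≤-reflexive; m≤n⇒m≤1+n)
open import Data.Product using (∃-syntax; ∃₂; _×_; _,_; proj₁; proj₂)
open import Data.Product.Properties using (≡-dec)
open import Data.Sum using (inj₁; inj₂; _⊎_; [_,_]′)
import Data.Vec as Vec
open import Data.Vec.Properties using ([]=⇒lookup; lookup⇒[]=; lookup∘tabulate)
open import Function using (_∘_; id; case_of_; mk⇔)
open import Level using (0ℓ)
open import Relation.Binary.Construct.Add.Supremum.NonStrict
  using ([_]; _≤⊤⁺; [≤]-injective; ≤⁺-trans)
open import Relation.Binary.PropositionalEquality
  using (_≡_; _≢_; refl; sym; trans; cong; subst; ≢-sym; setoid)
open import Relation.Nullary
  using (¬_; Dec; yes; no; does; contradiction; _×-dec_; _→-dec_; ¬?)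
open import Relation.Nullary.Construct.Add.Supremum using ([_]; ⊤⁺)
open import Relation.Nullary.Decidable using (dec-true)
open import Relation.Unary using (Pred; Decidable)

-- Lists without repetitions, and subsets

module _ {A : Set} where

  Unique-++ˡ : ∀ (xs : List A) {ys} → Unique (xs ++ ys) → Unique xs
  Unique-++ˡ [] _ = []
  Unique-++ˡ (x ∷ xs) (px ∷ u) = All.++⁻ˡ xs px ∷ Unique-++ˡ xs u

  Unique-++ʳ : ∀ (xs : List A) {ys} → Unique (xs ++ ys) → Unique ys
  Unique-++ʳ [] u = u
  Unique-++ʳ (x ∷ xs) (_ ∷ u) = Unique-++ʳ xs u

  Unique-disjoint : ∀ (xs : List A) {ys z} → Unique (xs ++ ys) → z ∈ xs → z ∈ ys → ⊥
  Unique-disjoint (x ∷ xs) (px ∷ u) (here refl) z∈ys = All.lookup px (∈-++⁺ʳ xs z∈ys) refl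
  Unique-disjoint (x ∷ xs) (px ∷ u) (there z∈xs) z∈ys = Unique-disjoint xs u z∈xs z∈ys

Unique-resp-↭ : ∀ {A : Set} {xs ys : List A} → xs ↭ ys → Unique xs → Unique ys
Unique-resp-↭ {A} p = Permₛ.Unique-resp-↭ (setoid A) (↭⇒↭ₛ p)

module _ {A : Set} where

  Unique-⊆⇒length≤ : ∀ {xs ys : List A} → Unique xs → (∀ {x} → x ∈ xs → x ∈ ys) → length xs ≤ length ys
  Unique-⊆⇒length≤ {[]} _ _ = z≤n
  Unique-⊆⇒length≤ {x ∷ xs} {ys} u@(_ ∷ u′) sub with ∈-∃++ (sub (here refl))
  ... | as , bs , refl = ≤-trans
    (s≤s (Unique-⊆⇒length≤ u′ λ z∈ → avoid z∈ (∈-resp-↭ (shift x as bs) (sub (there z∈)))))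
    (≤-reflexive (sym (↭-length (shift x as bs))))
    where
    avoid : ∀ {z} → z ∈ xs → z ∈ x ∷ as ++ bs → z ∈ as ++ bs
    avoid z∈ (here refl) = contradiction z∈ (Unique[x∷xs]⇒x∉xs u)
    avoid z∈ (there m)   = m

  length-concatMap≤ : ∀ {B : Set} (f : B → List A) c ws → (∀ {w} → w ∈ ws → length (f w) ≤ c) →
    length (concatMap f ws) ≤ length ws * c
  length-concatMap≤ f c []       _ = z≤n
  length-concatMap≤ f c (w ∷ ws) h rewrite length-++ (f w) {concatMap f ws} =
    ℕ.+-mono-≤ (h (here refl)) (length-concatMap≤ f c ws (h ∘ there))

  -- If no `w` took more than `c` elements, `xs` would lie in a concatenation of at most
  -- `length ws * c` elements.
  pigeonhole : ∀ {B : Set} {R : B → Pred A 0ℓ} (R? : ∀ b → Decidable (R b)) c ws {xs} → Unique xs →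
    (∀ {x} → x ∈ xs → ∃[ w ] w ∈ ws × R w x) → length ws * c < length xs →
    ∃[ w ] w ∈ ws × c < length (filter (R? w) xs)
  pigeonhole R? c ws {xs} u covered lt with Any.any? (λ w → c ℕ.<? length (filter (R? w) xs)) ws
  ... | yes found = let w , w∈ , c< = find found in w , w∈ , c<
  ... | no none = contradiction
    (≤-trans (Unique-⊆⇒length≤ u xs⊆)
      (length-concatMap≤ fibre c ws λ w∈ → ℕ.≮⇒≥ λ c< → none (lose w∈ c<)))
    (ℕ.<⇒≱ lt)
    where
    fibre = λ w → filter (R? w) xs
    xs⊆ : ∀ {x} → x ∈ xs → x ∈ concatMap fibre ws
    xs⊆ x∈ = let w , w∈ , r = covered x∈ in
      ∈-concatMap⁺ fibre (Any.map (λ { refl → ∈-filter⁺ (R? w) x∈ r }) w∈)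

∉-Unique : ∀ {A : Set} {x : A} {xs} → x ∉ xs → Unique xs → Unique (x ∷ xs)
∉-Unique x∉ u = All.tabulate (λ { y∈ refl → x∉ y∈ }) ∷ u

-- For counting closed neighbourhoods, where `f x` has one element more than the degree `d x`.
length-concatMap-suc : ∀ {A B : Set} (f : A → List B) (d : A → ℕ) xs → (∀ x → length (f x) ≡ suc (d x)) →
  length (concatMap f xs) ≡ sum (map d xs) + length xs
length-concatMap-suc f d []       h = refl
length-concatMap-suc f d (x ∷ xs) h
  rewrite length-++ (f x) {concatMap f xs} | h x | length-concatMap-suc f d xs h =
  trans (cong suc (sym (ℕ.+-assoc (d x) _ _))) (sym (ℕ.+-suc (d x + sum (map d xs)) (length xs)))

concatMap-Unique : ∀ {A B : Set} (f : A → List B) {xs} → Unique xs → (∀ {x} → x ∈ xs → Unique (f x)) →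
  (∀ {x y z} → x ∈ xs → y ∈ xs → x ≢ y → z ∈ f x → z ∈ f y → ⊥) → Unique (concatMap f xs)
concatMap-Unique f {[]}     _ _ _ = []
concatMap-Unique f {x ∷ xs} u uf disj = ++⁺-Unique (uf (here refl))
  (concatMap-Unique f (AllPairs.tail u) (uf ∘ there) (λ x∈ y∈ → disj (there x∈) (there y∈)))
  λ (z∈ , z∈′) → let y , y∈ , m = find (∈-concatMap⁻ f {xs} z∈′) in
    disj (here refl) (there y∈) (λ eq → Unique[x∷xs]⇒x∉xs u (subst (_∈ xs) (sym eq) y∈)) z∈ m

lookup-injective : ∀ {A : Set} {xs : List A} → Unique xs → ∀ i j → lookup xs i ≡ lookup xs j → i ≡ j
lookup-injective {xs = _ ∷ _} u zero zero eq = refl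
lookup-injective {xs = x ∷ xs} u zero (suc j) eq =
  contradiction (subst (_∈ xs) (sym eq) (∈-lookup j)) (Unique[x∷xs]⇒x∉xs u)
lookup-injective {xs = x ∷ xs} u (suc i) zero eq =
  contradiction (subst (_∈ xs) eq (∈-lookup i)) (Unique[x∷xs]⇒x∉xs u)
lookup-injective {xs = _ ∷ _} (_ ∷ u) (suc i) (suc j) eq = cong suc (lookup-injective u i j eq)

another : ∀ {n} {xs : List (Fin n)} → Unique xs → 2 ≤ length xs → ∀ x → ∃[ y ] y ∈ xs × y ≢ x
another {xs = y ∷ z ∷ _} ((y≢z ∷ _) ∷ _) _ x with y Fin.≟ x
... | no y≢x   = y , here refl , y≢x
... | yes refl = z , there (here refl) , ≢-sym y≢z
another {xs = _ ∷ []} _ (s≤s ())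

map-Unique : ∀ {A B : Set} (f : A → B) {xs} → Unique xs →
  (∀ {x y} → x ∈ xs → y ∈ xs → f x ≡ f y → x ≡ y) → Unique (map f xs)
map-Unique f {[]}     _ _ = []
map-Unique f {x ∷ xs} u inj = ∉-Unique
  (λ m → let y , y∈ , eq = ∈-map⁻ f m in
    Unique[x∷xs]⇒x∉xs u (subst (_∈ xs) (sym (inj (here refl) (there y∈) eq)) y∈))
  (map-Unique f (AllPairs.tail u) λ x∈ y∈ → inj (there x∈) (there y∈))

elements : ∀ {n} → Subset n → List (Fin n)
elements Vec.[]            = []
elements (inside  Vec.∷ p) = zero ∷ map suc (elements p)
elements (outside Vec.∷ p) = map suc (elements p)

∈-elements⁺ : ∀ {n} {p : Subset n} {x} → x ∈ˢ p → x ∈ elements p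
∈-elements⁺ Vec.here = here refl
∈-elements⁺ {p = inside  Vec.∷ p} (Vec.there x∈) = there (∈-map⁺ suc (∈-elements⁺ x∈))
∈-elements⁺ {p = outside Vec.∷ p} (Vec.there x∈) = ∈-map⁺ suc (∈-elements⁺ x∈)

∈-elements⁻ : ∀ {n} (p : Subset n) {x} → x ∈ elements p → x ∈ˢ p
∈-elements⁻ (inside Vec.∷ p) (here refl) = Vec.here
∈-elements⁻ (inside Vec.∷ p) (there x∈) with ∈-map⁻ suc x∈
... | _ , y∈ , refl = Vec.there (∈-elements⁻ p y∈)
∈-elements⁻ (outside Vec.∷ p) x∈ with ∈-map⁻ suc x∈
... | _ , y∈ , refl = Vec.there (∈-elements⁻ p y∈)

elements-Unique : ∀ {n} (p : Subset n) → Unique (elements p)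
elements-Unique Vec.[] = []
elements-Unique (inside Vec.∷ p) =
  ∉-Unique (λ z∈ → case ∈-map⁻ suc z∈ of λ { (_ , _ , ()) }) (map⁺ Fin.suc-injective (elements-Unique p))
elements-Unique (outside Vec.∷ p) = map⁺ Fin.suc-injective (elements-Unique p)

length-elements : ∀ {n} (p : Subset n) → length (elements p) ≡ ∣ p ∣
length-elements Vec.[] = refl
length-elements (inside  Vec.∷ p) = cong suc (trans (length-map suc (elements p)) (length-elements p))
length-elements (outside Vec.∷ p) = trans (length-map suc (elements p)) (length-elements p)

length≤∣_∣ : ∀ {n} (p : Subset n) {xs} → Unique xs → (∀ {x} → x ∈ xs → x ∈ˢ p) → length xs ≤ ∣ p ∣
length≤∣ p ∣ {xs} u sub = subst (length xs ≤_) (length-elements p) (Unique-⊆⇒length≤ u (∈-elements⁺ ∘ sub))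

∣_∣≤length : ∀ {n} (p : Subset n) {xs} → (∀ {x} → x ∈ˢ p → x ∈ xs) → ∣ p ∣ ≤ length xs
∣ p ∣≤length {xs} sub = subst (_≤ length xs) (length-elements p)
  (Unique-⊆⇒length≤ (elements-Unique p) (sub ∘ ∈-elements⁻ p))

module _ {n} {P : Pred (Fin n) 0ℓ} (P? : Decidable P) where

  ∈⟦⟧⁺ : ∀ {v} → P v → v ∈ˢ ⟦ P? ⟧
  ∈⟦⟧⁺ {v} pv = lookup⇒[]= v _ (trans (lookup∘tabulate _ v) (dec-true (P? v) pv))

  ∈⟦⟧⁻ : ∀ {v} → v ∈ˢ ⟦ P? ⟧ → P v
  ∈⟦⟧⁻ {v} v∈ with P? v | trans (sym (lookup∘tabulate (does ∘ P?) v)) ([]=⇒lookup v∈)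
  ... | yes pv | _ = pv

∈-subsets : ∀ {n} (p : Subset n) → p ∈ subsets n
∈-subsets Vec.[] = here refl
∈-subsets (inside  Vec.∷ p) = ∈-++⁺ˡ (∈-map⁺ _ (∈-subsets p))
∈-subsets {suc n} (outside Vec.∷ p) = ∈-++⁺ʳ (map (inside Vec.∷_) (subsets n)) (∈-map⁺ _ (∈-subsets p))

x∈p─q⇒x∉q : ∀ {n} (p : Subset n) {q x} → x ∈ˢ p ─ q → x ∉ˢ q
x∈p─q⇒x∉q (inside  Vec.∷ p) {outside Vec.∷ q} Vec.here      ()
x∈p─q⇒x∉q (s Vec.∷ p) {inside  Vec.∷ q} (Vec.there m) (Vec.there m′) = x∈p─q⇒x∉q p m m′
x∈p─q⇒x∉q (s Vec.∷ p) {outside Vec.∷ q} (Vec.there m) (Vec.there m′) = x∈p─q⇒x∉q p m m′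

-- Trees

-- node v kids sibs consists of the tree with root v whose branches at v form
-- the forest kids, and of the further trees sibs.
data Forest (A : Set) : Set where
  nil  : Forest A
  node : (v : A) (kids sibs : Forest A) → Forest A

Tree : Set → Set
Tree A = A × Forest A

module _ {A : Set} where

  verts : Forest A → List A
  verts nil          = []
  verts (node v k s) = v ∷ verts k ++ verts s

  roots : Forest A → List A
  roots nil          = []
  roots (node v _ s) = v ∷ roots s

  -- The childless vertices. Once the forest hangs below a root, these are the leaves of the tree
  -- other than possibly the root.
  ends : Forest A → List A
  ends nil                       = []
  ends (node v nil s)            = v ∷ ends s
  ends (node v k@(node _ _ _) s) = ends k ++ ends s

  arcsBelow : A → Forest A → List (A × A)
  arcsBelow p nil          = []
  arcsBelow p (node v k s) = (p , v) ∷ (v , p) ∷ arcsBelow v k ++ arcsBelow p s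

  -- The root of a tree is a leaf of it when it has at most one branch.
  rootLeaf : A → Forest A → List A
  rootLeaf p nil                     = p ∷ []
  rootLeaf p (node _ _ nil)          = p ∷ []
  rootLeaf p (node _ _ (node _ _ _)) = []

  vertices : Tree A → List A
  vertices (p , F) = p ∷ verts F

  -- Each edge is listed in both directions.
  arcs : Tree A → List (A × A)
  arcs (p , F) = arcsBelow p F

  leaves : Tree A → List A
  leaves (p , F) = rootLeaf p F ++ ends F

  -- Reordering branches and moving the root.

  infix 4 _∼_ _≈_

  -- Only the trees at the top level are permuted; deeper levels come within reach by moving the
  -- root.
  data _∼_ : Forest A → Forest A → Set where
    ∼-refl  : ∀ {F} → F ∼ F
    ∼-trans : ∀ {F G H} → F ∼ G → G ∼ H → F ∼ H
    ∼-prep  : ∀ v k {s s′} → s ∼ s′ → node v k s ∼ node v k s′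
    ∼-swap  : ∀ v k w j s → node v k (node w j s) ∼ node w j (node v k s)

  ∼-sym : ∀ {F G} → F ∼ G → G ∼ F
  ∼-sym ∼-refl             = ∼-refl
  ∼-sym (∼-trans r q)      = ∼-trans (∼-sym q) (∼-sym r)
  ∼-sym (∼-prep v k r)     = ∼-prep v k (∼-sym r)
  ∼-sym (∼-swap v k w j s) = ∼-swap w j v k s

  verts-∼ : ∀ {F G} → F ∼ G → verts F ↭ verts G
  verts-∼ ∼-refl             = ↭-refl
  verts-∼ (∼-trans r q)      = ↭-trans (verts-∼ r) (verts-∼ q)
  verts-∼ (∼-prep v k r)     = prep v (++⁺ˡ (verts k) (verts-∼ r))
  verts-∼ (∼-swap v k w j s) = shifts (v ∷ verts k) (w ∷ verts j)

  arcs-∼ : ∀ {F G} p → F ∼ G → arcsBelow p F ↭ arcsBelow p G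
  arcs-∼ p ∼-refl             = ↭-refl
  arcs-∼ p (∼-trans r q)      = ↭-trans (arcs-∼ p r) (arcs-∼ p q)
  arcs-∼ p (∼-prep v k r)     = prep _ (prep _ (++⁺ˡ (arcsBelow v k) (arcs-∼ p r)))
  arcs-∼ p (∼-swap v k w j s) =
    shifts ((p , v) ∷ (v , p) ∷ arcsBelow v k) ((p , w) ∷ (w , p) ∷ arcsBelow w j)

  ends-∼ : ∀ {F G} → F ∼ G → ends F ↭ ends G
  ends-∼ ∼-refl                         = ↭-refl
  ends-∼ (∼-trans r q)                  = ↭-trans (ends-∼ r) (ends-∼ q)
  ends-∼ (∼-prep v nil r)               = prep v (ends-∼ r)
  ends-∼ (∼-prep v k@(node _ _ _) r)    = ++⁺ˡ (ends k) (ends-∼ r)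
  ends-∼ (∼-swap v nil w nil s)         = swap v w ↭-refl
  ends-∼ (∼-swap v nil w j@(node _ _ _) s) = shifts (v ∷ []) (ends j)
  ends-∼ (∼-swap v k@(node _ _ _) w nil s) = shifts (ends k) (w ∷ [])
  ends-∼ (∼-swap v k@(node _ _ _) w j@(node _ _ _) s) = shifts (ends k) (ends j)

  ∼-nil : ∀ {F} → nil ∼ F → F ≡ nil
  ∼-nil ∼-refl = refl
  ∼-nil (∼-trans r q) rewrite ∼-nil r = ∼-nil q

  rootLeaf-∼ : ∀ {F G} p → F ∼ G → rootLeaf p F ≡ rootLeaf p G
  rootLeaf-∼ p ∼-refl = refl
  rootLeaf-∼ p (∼-trans r q) = trans (rootLeaf-∼ p r) (rootLeaf-∼ p q)
  rootLeaf-∼ p (∼-prep v k {nil} r) rewrite ∼-nil r = refl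
  rootLeaf-∼ p (∼-prep v k {node _ _ _} {nil} r) with () ← ∼-nil (∼-sym r)
  rootLeaf-∼ p (∼-prep v k {node _ _ _} {node _ _ _} r) = refl
  rootLeaf-∼ p (∼-swap v k w j s) = refl

  -- Equality of trees up to the choice of the root and the order of branches, recorded through the
  -- three lists on which all later notions depend.
  record _≈_ (T U : Tree A) : Set where
    constructor mk≈
    field
      vertices↭ : vertices T ↭ vertices U
      arcs↭     : arcs T ↭ arcs U
      leaves↭   : leaves T ↭ leaves U

  open _≈_ public

  ≈-refl : ∀ {T} → T ≈ T
  ≈-refl = mk≈ ↭-refl ↭-refl ↭-refl

  ≈-trans : ∀ {T U W} → T ≈ U → U ≈ W → T ≈ W
  ≈-trans (mk≈ a b c) (mk≈ a′ b′ c′) = mk≈ (↭-trans a a′) (↭-trans b b′) (↭-trans c c′)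

  ≈-sym : ∀ {T U : Tree A} → T ≈ U → U ≈ T
  ≈-sym (mk≈ a b c) = mk≈ (↭-sym a) (↭-sym b) (↭-sym c)

  siblings : ∀ {F G} p → F ∼ G → (p , F) ≈ (p , G)
  siblings {F} {G} p r = mk≈ (prep p (verts-∼ r)) (arcs-∼ p r)
    (subst (λ xs → leaves (p , F) ↭ xs ++ ends G) (rootLeaf-∼ p r)
      (++⁺ˡ (rootLeaf p F) (ends-∼ r)))

  -- Seen from either end of the edge, `p` is a leaf exactly when `s` is empty, and `v` exactly when
  -- `k` is empty.
  rotate-leaves : ∀ p v k s → leaves (p , node v k s) ↭ leaves (v , node p s k)
  rotate-leaves p v nil nil = swap p v ↭-refl
  rotate-leaves p v nil (node _ _ _) = prep v (++-comm [] _)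
  rotate-leaves p v (node _ _ _) nil = prep p (++-comm _ [])
  rotate-leaves p v k@(node _ _ _) s@(node _ _ _) = ++-comm (ends k) (ends s)

  rotate : ∀ p v k s → (p , node v k s) ≈ (v , node p s k)
  rotate p v k s = mk≈ (swap p v (++-comm (verts k) (verts s)))
    (swap (p , v) (v , p) (++-comm (arcsBelow v k) (arcsBelow p s)))
    (rotate-leaves p v k s)

  _⊕_ : Forest A → Forest A → Forest A
  nil        ⊕ D = D
  node v k s ⊕ D = node v k (s ⊕ D)

  ⊕-nil : ∀ F → F ⊕ nil ≡ F
  ⊕-nil nil = refl
  ⊕-nil (node v k s) = cong (node v k) (⊕-nil s)

  ⊕-node : ∀ v k s D → node v k (s ⊕ D) ∼ s ⊕ node v k D
  ⊕-node v k nil D = ∼-refl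
  ⊕-node v k (node w j s) D = ∼-trans (∼-swap v k w j (s ⊕ D)) (∼-prep w j (⊕-node v k s D))

  -- `D` collects the branches that the search has passed, which keeps the recursion structural in
  -- `F`. On descending into `k`, all the rest of the tree becomes one further branch at `v`.
  reroot-⊕ : ∀ {x} p F D → x ∈ verts F → ∃[ R ] (p , F ⊕ D) ≈ (x , R)
  reroot-⊕ p (node v k s) D (here refl) = node p (s ⊕ D) k , rotate p v k (s ⊕ D)
  reroot-⊕ p (node v k s) D (there x∈) with ∈-++⁻ (verts k) x∈
  ... | inj₁ x∈k =
    let R , e = reroot-⊕ v k (node p (s ⊕ D) nil) x∈k in
    R , ≈-trans (rotate p v k (s ⊕ D)) (≈-trans
          (subst (λ H → (v , node p (s ⊕ D) H) ≈ (v , k ⊕ node p (s ⊕ D) nil)) (⊕-nil k)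
             (siblings v (⊕-node p (s ⊕ D) k nil))) e)
  ... | inj₂ x∈s =
    let R , e = reroot-⊕ p s (node v k D) x∈s in
    R , ≈-trans (siblings p (⊕-node v k s D)) e

  reroot : ∀ {x} T → x ∈ vertices T → ∃[ F ] T ≈ (x , F)
  reroot (p , F) (here refl) = F , ≈-refl
  reroot (p , F) (there x∈F) =
    let R , e = reroot-⊕ p F nil x∈F in
    R , subst (λ H → (p , H) ≈ (_ , R)) (⊕-nil F) e

  ends⊆verts : ∀ F {x} → x ∈ ends F → x ∈ verts F
  ends⊆verts (node v nil s) (here refl) = here refl
  ends⊆verts (node v nil s) (there x∈)  = there (ends⊆verts s x∈)
  ends⊆verts (node v k@(node _ _ _) s) x∈ =
    [ (λ x∈k → there (∈-++⁺ˡ (ends⊆verts k x∈k)))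
    , (λ x∈s → there (∈-++⁺ʳ (verts k) (ends⊆verts s x∈s))) ]′ (∈-++⁻ (ends k) x∈)

  leaves⊆vertices : ∀ T {x} → x ∈ leaves T → x ∈ vertices T
  leaves⊆vertices (p , nil) x∈ = x∈
  leaves⊆vertices (p , F@(node _ _ nil)) (here x≡p) = here x≡p
  leaves⊆vertices (p , F@(node _ _ nil)) (there x∈) = there (ends⊆verts F x∈)
  leaves⊆vertices (p , F@(node _ _ (node _ _ _))) x∈ = there (ends⊆verts F x∈)

  roots⊆verts : ∀ F {x} → x ∈ roots F → x ∈ verts F
  roots⊆verts (node v k s) (here x≡v) = here x≡v
  roots⊆verts (node v k s) (there x∈) = there (∈-++⁺ʳ (verts k) (roots⊆verts s x∈))

  front : ∀ F {x} → x ∈ roots F → ∃₂ λ k R → F ∼ node x k R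
  front (node v k s) (here refl) = k , s , ∼-refl
  front (node v k s) (there x∈) =
    let j , R , e = front s x∈ in
    j , node v k R , ∼-trans (∼-prep v k e) (∼-swap v k _ j R)

  roots-∼ : ∀ {F G} → F ∼ G → roots F ↭ roots G
  roots-∼ ∼-refl             = ↭-refl
  roots-∼ (∼-trans r q)      = ↭-trans (roots-∼ r) (roots-∼ q)
  roots-∼ (∼-prep v k r)     = prep v (roots-∼ r)
  roots-∼ (∼-swap v k w j s) = swap v w ↭-refl

  roots⇒arc : ∀ p F {x} → x ∈ roots F → (p , x) ∈ arcsBelow p F
  roots⇒arc p (node v k s) (here refl) = here refl
  roots⇒arc p (node v k s) (there x∈)  = there (there (∈-++⁺ʳ (arcsBelow v k) (roots⇒arc p s x∈)))

  arc⇒∈ : ∀ p F {a b} → (a , b) ∈ arcsBelow p F → a ∈ p ∷ verts F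
  arc⇒∈ p (node v k s) (here refl) = here refl
  arc⇒∈ p (node v k s) (there (here refl)) = there (here refl)
  arc⇒∈ p (node v k s) (there (there e)) with ∈-++⁻ (arcsBelow v k) e
  ... | inj₁ e′ = there (∈-++⁺ˡ (arc⇒∈ v k e′))
  ... | inj₂ e′ with arc⇒∈ p s e′
  ...   | here refl = here refl
  ...   | there m   = there (there (∈-++⁺ʳ (verts k) m))

  arc-sym : ∀ p F {a b} → (a , b) ∈ arcsBelow p F → (b , a) ∈ arcsBelow p F
  arc-sym p (node v k s) (here refl) = there (here refl)
  arc-sym p (node v k s) (there (here refl)) = here refl
  arc-sym p (node v k s) (there (there e)) with ∈-++⁻ (arcsBelow v k) e
  ... | inj₁ e′ = there (there (∈-++⁺ˡ (arc-sym v k e′)))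
  ... | inj₂ e′ = there (there (∈-++⁺ʳ (arcsBelow v k) (arc-sym p s e′)))

  -- Below p F a b : a is the parent of b in the tree (p , F).
  data Below : A → Forest A → A → A → Set where
    top  : ∀ {p v k s} → Below p (node v k s) p v
    down : ∀ {p v k s a b} → Below v k a b → Below p (node v k s) a b
    next : ∀ {p v k s a b} → Below p s a b → Below p (node v k s) a b

  arc⇒Below : ∀ p F {a b} → (a , b) ∈ arcsBelow p F → Below p F a b ⊎ Below p F b a
  arc⇒Below p (node v k s) (here refl) = inj₁ top
  arc⇒Below p (node v k s) (there (here refl)) = inj₂ top
  arc⇒Below p (node v k s) (there (there e)) with ∈-++⁻ (arcsBelow v k) e
  ... | inj₁ e′ with arc⇒Below v k e′
  ...   | inj₁ d = inj₁ (down d)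
  ...   | inj₂ d = inj₂ (down d)
  arc⇒Below p (node v k s) (there (there e)) | inj₂ e′ with arc⇒Below p s e′
  ...   | inj₁ d = inj₁ (next d)
  ...   | inj₂ d = inj₂ (next d)

  Below⇒∈ : ∀ {p F a b} → Below p F a b → b ∈ verts F
  Below⇒∈ top = here refl
  Below⇒∈ {F = node v k s} (down d) = there (∈-++⁺ˡ (Below⇒∈ d))
  Below⇒∈ {F = node v k s} (next d) = there (∈-++⁺ʳ (verts k) (Below⇒∈ d))

  Below-unique : ∀ {p F a a′ b} → Unique (verts F) → Below p F a b → Below p F a′ b → a ≡ a′
  Below-unique {F = node v k s} u top top = refl
  Below-unique {F = node v k s} u top (down d) = ⊥-elim (Unique[x∷xs]⇒x∉xs u (∈-++⁺ˡ (Below⇒∈ d)))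
  Below-unique {F = node v k s} u top (next d) = ⊥-elim (Unique[x∷xs]⇒x∉xs u (∈-++⁺ʳ (verts k) (Below⇒∈ d)))
  Below-unique {F = node v k s} u (down d) top = ⊥-elim (Unique[x∷xs]⇒x∉xs u (∈-++⁺ˡ (Below⇒∈ d)))
  Below-unique {F = node v k s} u (next d) top = ⊥-elim (Unique[x∷xs]⇒x∉xs u (∈-++⁺ʳ (verts k) (Below⇒∈ d)))
  Below-unique {F = node v k s} (_ ∷ u) (down d) (down d′) = Below-unique (Unique-++ˡ (verts k) u) d d′
  Below-unique {F = node v k s} (_ ∷ u) (next d) (next d′) = Below-unique (Unique-++ʳ (verts k) u) d d′
  Below-unique {F = node v k s} (_ ∷ u) (down d) (next d′) =
    ⊥-elim (Unique-disjoint (verts k) u (Below⇒∈ d) (Below⇒∈ d′))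
  Below-unique {F = node v k s} (_ ∷ u) (next d) (down d′) =
    ⊥-elim (Unique-disjoint (verts k) u (Below⇒∈ d′) (Below⇒∈ d))

  arc-root : ∀ p F {a} → Unique (p ∷ verts F) → (p , a) ∈ arcsBelow p F → a ∈ roots F
  arc-root p (node v k s) u (here refl) = here refl
  arc-root p (node v k s) u (there (here refl)) = ⊥-elim (Unique[x∷xs]⇒x∉xs u (here refl))
  arc-root p (node v k s) u (there (there e)) with ∈-++⁻ (arcsBelow v k) e
  ... | inj₁ e′ = ⊥-elim (Unique[x∷xs]⇒x∉xs u (∈-++⁺ˡ (arc⇒∈ v k e′)))
  arc-root p (node v k s) ((_ ∷ p≢) ∷ _ ∷ u) (there (there e)) | inj₂ e′ =
    there (arc-root p s (All.++⁻ʳ (verts k) p≢ ∷ Unique-++ʳ (verts k) u) e′)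

  -- A root with two branches is not in `rootLeaf`, and as it occurs only once it is not in `ends`
  -- either.
  leaf-at-root : ∀ {x} F → Unique (x ∷ verts F) → x ∈ leaves (x , F) →
    F ≡ nil ⊎ ∃₂ λ u k → F ≡ node u k nil
  leaf-at-root nil _ _ = inj₁ refl
  leaf-at-root (node u k nil) _ _ = inj₂ (u , k , refl)
  leaf-at-root F@(node _ _ (node _ _ _)) uniq x∈ = ⊥-elim (Unique[x∷xs]⇒x∉xs uniq (ends⊆verts F x∈))

  inner-at-root : ∀ {x} F → x ∉ leaves (x , F) → ∃₂ λ a j → ∃₂ λ b k → ∃[ R ] F ≡ node a j (node b k R)
  inner-at-root nil x∉ = ⊥-elim (x∉ (here refl))
  inner-at-root (node _ _ nil) x∉ = ⊥-elim (x∉ (here refl))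
  inner-at-root (node a j (node b k R)) _ = a , j , b , k , R , refl

  ends-node : ∀ v k s → ends (node v k s) ≡ ends (node v k nil) ++ ends s
  ends-node v nil s = refl
  ends-node v k@(node _ _ _) s = cong (_++ ends s) (sym (++-identityʳ (ends k)))

  -- Deleting the leaf `x` can create only one new leaf, its neighbour `u`, which then takes the
  -- place of `x`.
  chop-leaves : ∀ x u k → length (leaves (u , k)) ≤ length (leaves (x , node u k nil))
  chop-leaves x u nil = s≤s z≤n
  chop-leaves x u k@(node _ _ nil) = s≤s (length-++-≤ˡ (ends k))
  chop-leaves x u k@(node _ _ (node _ _ _)) = m≤n⇒m≤1+n (length-++-≤ˡ (ends k))

  path : List A → Forest A → Forest A
  path []       F = F
  path (a ∷ as) F = node a (path as F) nil

  verts-path : ∀ as F → verts (path as F) ≡ as ++ verts F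
  verts-path []       F = refl
  verts-path (a ∷ as) F = cong (a ∷_) (trans (++-identityʳ _) (verts-path as F))

  ends-path : ∀ as u k → ends (path as (node u k nil)) ≡ ends (node u k nil)
  ends-path []       u k = refl
  ends-path (a ∷ []) u k = ++-identityʳ _
  ends-path (a ∷ b ∷ as) u k = trans (++-identityʳ _) (ends-path (b ∷ as) u k)

  -- The new end `h` replaces `x` as a leaf; the other vertices of the path have one branch each and
  -- contribute nothing.
  leaves-path : ∀ h as x u k →
    length (leaves (h , path (as ++ x ∷ []) (node u k nil))) ≡ length (leaves (x , node u k nil))
  leaves-path h []       x u k = cong (suc ∘ length) (ends-path (x ∷ []) u k)
  leaves-path h (a ∷ as) x u k = cong (suc ∘ length) (ends-path (a ∷ as ++ x ∷ []) u k)

-- A root that is also an end has no branches, since it occurs only once. So the forest consists of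
-- single vertices.
flat : ∀ {A : Set} (F : Forest A) → Unique (verts F) → (∀ {r} → r ∈ roots F → r ∈ ends F) →
  ∀ {x} → x ∈ ends F → x ∈ roots F
flat (node v nil s) u h (here refl) = here refl
flat (node v nil s) u h (there x∈) = there (flat s (AllPairs.tail u) h′ x∈)
  where
  h′ : ∀ {r} → r ∈ roots s → r ∈ ends s
  h′ r∈ with h (there r∈)
  ... | here refl = contradiction (roots⊆verts s r∈) (Unique[x∷xs]⇒x∉xs u)
  ... | there m   = m
flat (node v k@(node _ _ _) s) u h x∈ = contradiction
  ([ ∈-++⁺ˡ ∘ ends⊆verts k , ∈-++⁺ʳ (verts k) ∘ ends⊆verts s ]′ (∈-++⁻ (ends k) (h (here refl))))
  (Unique[x∷xs]⇒x∉xs u)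

module _ {A : Set} where

  -- With `x` as root, its neighbour `w` must have a branch, as a single edge has only two leaves.
  -- Hence `w` is neither the root nor an end.
  leafNeighbour : ∀ {T : Tree A} {x} → Unique (vertices T) → 3 ≤ length (leaves T) → x ∈ leaves T →
    ∃[ w ] w ∉ leaves T × (w , x) ∈ arcs T
  leafNeighbour {T} {x} u three x∈ with reroot T (leaves⊆vertices T x∈)
  ... | F , e with Unique-resp-↭ (vertices↭ e) u
  ...   | u₁ with leaf-at-root F u₁ (∈-resp-↭ (leaves↭ e) x∈)
  ...     | inj₁ refl = contradiction (subst (3 ≤_) (↭-length (leaves↭ e)) three) λ { (s≤s ()) }
  ...     | inj₂ (w , nil , refl) =
    contradiction (subst (3 ≤_) (↭-length (leaves↭ e)) three) λ { (s≤s (s≤s ())) }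
  ...     | inj₂ (w , k@(node _ _ _) , refl) =
    w , (λ m → not-leaf (∈-resp-↭ (leaves↭ e) m)) , ∈-resp-↭ (↭-sym (arcs↭ e)) (there (here refl))
    where
    not-leaf : w ∉ x ∷ ends k ++ []
    not-leaf (here refl) = Unique[x∷xs]⇒x∉xs u₁ (here refl)
    not-leaf (there m)   = Unique[x∷xs]⇒x∉xs (AllPairs.tail u₁)
      (∈-++⁺ˡ (ends⊆verts k (subst (w ∈_) (++-identityʳ (ends k)) m)))

  -- With `w` as root, `flat` shows that every branch is a single vertex: the tree is a star with
  -- centre `w`.
  leaves-around : ∀ {T : Tree A} {w x} → Unique (vertices T) → w ∈ vertices T → w ∉ leaves T →
    (∀ {a} → (w , a) ∈ arcs T → a ∈ leaves T) → x ∈ leaves T → (w , x) ∈ arcs T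
  leaves-around {T} {w} {x} u w∈ w∉ all x∈ with reroot T w∈
  ... | F , e with inner-at-root F (w∉ ∘ ∈-resp-↭ (↭-sym (leaves↭ e)))
  ...   | a , j , b , k , R , refl = ∈-resp-↭ (↭-sym (arcs↭ e)) (roots⇒arc w F
    (flat F (AllPairs.tail (Unique-resp-↭ (vertices↭ e) u))
      (λ r∈ → ∈-resp-↭ (leaves↭ e) (all (∈-resp-↭ (↭-sym (arcs↭ e)) (roots⇒arc w F r∈))))
      (∈-resp-↭ (leaves↭ e) x∈)))

ends-Unique : ∀ {A : Set} (F : Forest A) → Unique (verts F) → Unique (ends F)
ends-Unique nil _ = []
ends-Unique (node v nil s) u = ∉-Unique (Unique[x∷xs]⇒x∉xs u ∘ ends⊆verts s) (ends-Unique s (AllPairs.tail u))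
ends-Unique (node v k@(node _ _ _) s) (_ ∷ u) = ++⁺-Unique
  (ends-Unique k (Unique-++ˡ (verts k) u)) (ends-Unique s (Unique-++ʳ (verts k) u))
  λ (m , m′) → Unique-disjoint (verts k) u (ends⊆verts k m) (ends⊆verts s m′)

leaves-Unique : ∀ {A : Set} (T : Tree A) → Unique (vertices T) → Unique (leaves T)
leaves-Unique (p , nil) u = u
leaves-Unique (p , F@(node _ _ nil)) u =
  ∉-Unique (Unique[x∷xs]⇒x∉xs u ∘ ends⊆verts F) (ends-Unique F (AllPairs.tail u))
leaves-Unique (p , F@(node _ _ (node _ _ _))) u = ends-Unique F (AllPairs.tail u)

nil⇒leaf : ∀ {A : Set} (T : Tree A) {v} → proj₂ T ≡ nil → v ∈ vertices T → v ∈ leaves T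
nil⇒leaf (p , nil) refl v∈ = v∈

-- Distances and degree sums

minimum≤ : ∀ {n xs} → n ∈ xs → minimum xs ≤∞ [ n ]
minimum≤ n∈ = All.lookup (min≤xs ⊤⁺ _) (∈-map⁺ [_] n∈)

≤minimum : ∀ {n xs} → (∀ {m} → m ∈ xs → n ≤ m) → [ n ] ≤∞ minimum xs
≤minimum {n} h = v≤min⁺ {v = [ n ]} (_ ≤⊤⁺) (All.map⁺ (All.tabulate λ m∈ → [ h m∈ ]))

module _ {N} (G : Graph N) where

  σ≤ : ∀ {m p S} → Admissible m p G S → σ m p G ≤∞ [ degSum G S ]
  σ≤ {m} {p} {S} adm = minimum≤ (∈-map⁺ (degSum G) (∈-filter⁺ (admissible? m p G) (∈-subsets S) adm))

  ≤dist : ∀ {m u v} → (∀ k → k < m → ¬ Walk G k u v) → [ m ] ≤∞ dist G u v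
  ≤dist {m} {u} {v} none = ≤minimum λ {k} k∈ →
    ℕ.≮⇒≥ λ k< → none k k< (proj₂ (∈-filter⁻ (λ k → walk? G k u v) {xs = upTo N} k∈))

-- Dominating subtrees

module _ {N} (G : Graph N) where

  open DecMembership (Fin._≟_ {N}) using () renaming (_∈?_ to _∈ˡ?_)

  record VertexList (xs : List (Fin N)) : Set where
    field
      distinct : Unique xs
      inGraph   : ∀ {v} → v ∈ xs → v ∈ˢ V G

  open VertexList public

  VertexList-resp-↭ : ∀ {xs ys} → xs ↭ ys → VertexList xs → VertexList ys
  VertexList-resp-↭ p vl = record
    { distinct = Unique-resp-↭ p (distinct vl)
    ; inGraph   = inGraph vl ∘ ∈-resp-↭ (↭-sym p)
    }

  VertexList-∷ : ∀ {x xs} → x ∈ˢ V G → x ∉ xs → VertexList xs → VertexList (x ∷ xs)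
  VertexList-∷ x∈ x∉ vl = record
    { distinct = ∉-Unique x∉ (distinct vl)
    ; inGraph   = λ { (here refl) → x∈ ; (there v∈) → inGraph vl v∈ }
    }

  record Subtree (T : Tree (Fin N)) : Set where
    field
      vertexList : VertexList (vertices T)
      edge       : ∀ {a b} → (a , b) ∈ arcs T → Adj G a b

  open Subtree public

  Dominates : List (Fin N) → Set
  Dominates xs = ∀ {v} → v ∈ˢ V G → v ∈ xs ⊎ ∃[ s ] s ∈ xs × Adj G v s

  Subtree-resp-≈ : ∀ {T U} → T ≈ U → Subtree T → Subtree U
  Subtree-resp-≈ e st = record
    { vertexList = VertexList-resp-↭ (vertices↭ e) (vertexList st)
    ; edge       = edge st ∘ ∈-resp-↭ (↭-sym (arcs↭ e))
    }

  Dominates-⊆ : ∀ {xs ys} → (∀ {v} → v ∈ xs → v ∈ ys) → Dominates xs → Dominates ys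
  Dominates-⊆ sub dom v∈ with dom v∈
  ... | inj₁ m           = inj₁ (sub m)
  ... | inj₂ (s , m , e) = inj₂ (s , sub m , e)

  -- Private neighbours and pruning.

  Private : Tree (Fin N) → Fin N → Fin N → Set
  Private T x y = y ∈ˢ V G × y ∉ vertices T × Adj G y x × (∀ s → s ∈ vertices T → Adj G y s → s ≡ x)

  private? : ∀ T x y → Dec (Private T x y)
  private? T x y = (y ∈? V G) ×-dec (¬? (y ∈ˡ? vertices T)) ×-dec (adj? G y x) ×-dec only
    where
    only : Dec (∀ s → s ∈ vertices T → Adj G y s → s ≡ x)
    only with All.all? (λ s → adj? G y s →-dec (s Fin.≟ x)) (vertices T)
    ... | yes h = yes λ _ → All.lookup h
    ... | no ¬h = no λ h → ¬h (All.tabulate λ {s} → h s)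

  -- The first alternative is the tree with one vertex, at which pruning has to stop.
  Pruned : Tree (Fin N) → Set
  Pruned T = proj₂ T ≡ nil ⊎ (∀ {x} → x ∈ leaves T → ∃[ y ] Private T x y)

  -- `R` is `_≤_` for pruning and `_<_` for a step that gains a leaf.
  record Smaller (T : Tree (Fin N)) (R : ℕ → ℕ → Set) : Set where
    field
      tree      : Tree (Fin N)
      subtree   : Subtree tree
      dominates : Dominates (vertices tree)
      fewer     : R (length (leaves tree)) (length (leaves T))

  open Smaller public

  -- `x` itself stays dominated by `u`. A vertex that loses its domination has `x` as its only
  -- neighbour in the tree and is therefore a private neighbour of `x`.
  removeLeaf : ∀ {x u k} → Subtree (x , node u k nil) → Dominates (vertices (x , node u k nil)) →
    ¬ (∃[ y ] Private (x , node u k nil) x y) → Subtree (u , k) × Dominates (vertices (u , k))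
  removeLeaf {x} {u} {k} st dom none = st′ , dom′
    where
    T = x , node u k nil
    ∈T : ∀ {v} → v ∈ vertices T → v ≡ x ⊎ v ∈ u ∷ verts k
    ∈T (here v≡x) = inj₁ v≡x
    ∈T {v} (there v∈) = inj₂ (subst (v ∈_) (++-identityʳ (u ∷ verts k)) v∈)
    st′ : Subtree (u , k)
    st′ = record
      { vertexList = record
          { distinct = case distinct (vertexList st) of λ { (_ ∷ d) → Unique-++ˡ (u ∷ verts k) d }
          ; inGraph   = inGraph (vertexList st) ∘ there ∘ ∈-++⁺ˡ
          }
      ; edge = edge st ∘ there ∘ there ∘ ∈-++⁺ˡ
      }
    dom′ : Dominates (u ∷ verts k)
    dom′ {v} v∈ with v ∈ˡ? u ∷ verts k | Any.any? (adj? G v) (u ∷ verts k)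
    ... | yes m | _     = inj₁ m
    ... | no _  | yes a = inj₂ (find a)
    ... | no v∉ | no ¬a with dom v∈
    ...   | inj₁ v∈T = case ∈T v∈T of λ where
              (inj₁ refl) → contradiction (here (edge st (here refl))) ¬a
              (inj₂ m)    → contradiction m v∉
    ...   | inj₂ (s , s∈T , vs) = case ∈T s∈T of λ where
              (inj₂ m)    → contradiction (lose m vs) ¬a
              (inj₁ refl) → contradiction
                (v , v∈ , (λ m → [ (λ { refl → adj-irr G vs }) , v∉ ]′ (∈T m)) , vs ,
                  λ _ m va → [ id , (λ m′ → contradiction (lose m′ va) ¬a) ]′ (∈T m)) none

  Private-resp-≈ : ∀ {T U x y} → T ≈ U → Private T x y → Private U x y
  Private-resp-≈ e (y∈ , y∉ , yx , only) =
    y∈ , y∉ ∘ ∈-resp-↭ (↭-sym (vertices↭ e)) , yx , λ s → only s ∘ ∈-resp-↭ (↭-sym (vertices↭ e))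

  -- Each deletion of a leaf without private neighbour lowers the number of vertices, which `n`
  -- bounds, and does not raise the number of leaves.
  prune : ∀ n T → length (vertices T) ≤ n → Subtree T → Dominates (vertices T) →
    ∃[ s ] Pruned (tree {T} {_≤_} s)
  prune (suc n) T size st dom
    with All.all? (λ x → Fin.any? (private? T x)) (leaves T)
  ... | yes all = record { tree = T ; subtree = st ; dominates = dom ; fewer = ≤-refl } ,
                  inj₂ (All.lookup all)
  ... | no ¬all with find (All.¬All⇒Any¬ (λ x → Fin.any? (private? T x)) _ ¬all)
  ...   | x , x∈ , none with reroot T (leaves⊆vertices T x∈)
  ...     | F , e with leaf-at-root F (distinct (vertexList (Subtree-resp-≈ e st))) (∈-resp-↭ (leaves↭ e) x∈)
  ...       | inj₁ refl =
    record { tree = x , nil ; subtree = Subtree-resp-≈ e st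
           ; dominates = Dominates-⊆ (∈-resp-↭ (vertices↭ e)) dom
           ; fewer = ≤-reflexive (sym (↭-length (leaves↭ e))) } , inj₁ refl
  ...       | inj₂ (u , k , refl) =
    let st′ , dom′ = removeLeaf (Subtree-resp-≈ e st) (Dominates-⊆ (∈-resp-↭ (vertices↭ e)) dom)
                       (λ (y , p) → none (y , Private-resp-≈ (≈-sym e) p))
        small , pruned = prune n (u , k) size′ st′ dom′
    in record { tree = tree small ; subtree = subtree small ; dominates = dominates small
              ; fewer = ≤-trans (fewer small) (≤-trans (chop-leaves x u k)
                          (≤-reflexive (sym (↭-length (leaves↭ e))))) } , pruned
    where
    size′ : length (u ∷ verts k) ≤ n
    size′ = ℕ.≤-pred (≤-trans (s≤s (length-++-≤ˡ (u ∷ verts k)))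
      (≤-trans (≤-reflexive (sym (↭-length (vertices↭ e)))) size))

  -- Lowering the number of leaves by a path or by an exchange of edges.

  edges-path : ∀ h as {x F} → Linked (Adj G) (h ∷ as ++ x ∷ []) →
    (∀ {a b} → (a , b) ∈ arcsBelow x F → Adj G a b) →
    ∀ {a b} → (a , b) ∈ arcsBelow h (path (as ++ x ∷ []) F) → Adj G a b
  edges-path h [] (hx ∷ _) edges (here refl)         = hx
  edges-path h [] (hx ∷ _) edges (there (here refl)) = adj-sym G hx
  edges-path h [] {x} {F} (hx ∷ _) edges (there (there m)) =
    edges (subst (_ ∈_) (++-identityʳ (arcsBelow x F)) m)
  edges-path h (c ∷ as) (hc ∷ _) edges (here refl)         = hc
  edges-path h (c ∷ as) (hc ∷ _) edges (there (here refl)) = adj-sym G hc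
  edges-path h (c ∷ as) {x} {F} (_ ∷ link) edges (there (there m)) =
    edges-path c as link edges (subst (_ ∈_) (++-identityʳ (arcsBelow c (path (as ++ x ∷ []) F))) m)

  -- Rerooted at its leaf `x`, the tree continues the path from `h` through `cs` to `x`. The leaf
  -- `x` is lost and `h` is gained.
  close : ∀ h cs {x u a b F} → Linked (Adj G) (h ∷ cs ++ x ∷ []) →
    VertexList (h ∷ cs ++ vertices (u , F)) → Dominates (h ∷ cs ++ vertices (u , F)) →
    (∀ {a b} → (a , b) ∈ arcs (u , F) → Adj G a b) → (u , F) ≈ (x , node a b nil) →
    ∃[ U ] Subtree U × Dominates (vertices U) × length (leaves U) ≡ length (leaves (u , F))
  close h cs {x} {u} {a} {b} {F} link vl dom edges e = (h , path (cs ++ x ∷ []) (node a b nil)) ,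
    record { vertexList = VertexList-resp-↭ same vl
           ; edge = edges-path h cs link (edges ∘ ∈-resp-↭ (↭-sym (arcs↭ e))) } ,
    Dominates-⊆ (∈-resp-↭ same) dom ,
    trans (leaves-path h cs x a b) (sym (↭-length (leaves↭ e)))
    where
    same : h ∷ cs ++ vertices (u , F) ↭ h ∷ verts (path (cs ++ x ∷ []) (node a b nil))
    same = prep h (↭-trans (++⁺ˡ cs (vertices↭ e))
      (Perm.↭-reflexive (sym (trans (verts-path (cs ++ x ∷ []) (node a b nil)) (++-assoc cs (x ∷ []) _)))))

  -- The list h ∷ cs ends in a neighbour of the leaf x of the tree node u k nil,
  -- and that tree hangs at h.  It is cut off from h at the first vertex with
  -- two branches, and attached to the other end of the list at x instead.
  unfold : ∀ h cs {x} u k → Linked (Adj G) (h ∷ cs ++ x ∷ []) → Adj G h u →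
    VertexList (h ∷ cs ++ vertices (u , k)) → Dominates (h ∷ cs ++ vertices (u , k)) →
    (∀ {a b} → (a , b) ∈ arcs (u , k) → Adj G a b) →
    x ∈ ends (node u k nil) → 2 ≤ length (ends (node u k nil)) →
    ∃[ U ] Subtree U × Dominates (vertices U) × length (leaves U) ≤ length (ends (node u k nil))
  unfold h cs u nil _ _ _ _ _ _ (s≤s ())
  unfold h cs {x} u k@(node v j nil) link hu vl dom edges x∈ two =
    subst (λ xs → ∃[ U ] Subtree U × Dominates (vertices U) × length (leaves U) ≤ length xs)
      (sym (++-identityʳ (ends k)))
      (unfold u (h ∷ cs) v j (adj-sym G hu ∷ link) (edges (here refl))
        (VertexList-resp-↭ same vl) (Dominates-⊆ (∈-resp-↭ same) dom)
        (edges ∘ there ∘ there ∘ ∈-++⁺ˡ)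
        (subst (x ∈_) (++-identityʳ (ends k)) x∈)
        (subst (λ xs → 2 ≤ length xs) (++-identityʳ (ends k)) two))
    where
    same : h ∷ cs ++ u ∷ v ∷ verts j ++ [] ↭ u ∷ h ∷ cs ++ v ∷ verts j
    same = ↭-trans (shift u (h ∷ cs) _)
      (Perm.↭-reflexive (cong (λ xs → u ∷ h ∷ cs ++ v ∷ xs) (++-identityʳ (verts j))))
  -- Here `u` has two branches, so it does not become a leaf when its edge to `h` is cut.
  unfold h cs {x} u k@(node _ _ (node _ _ _)) link hu vl dom edges x∈ two
    with x∈k ← subst (x ∈_) (++-identityʳ (ends k)) x∈
    with reroot (u , k) (leaves⊆vertices (u , k) x∈k)
  ... | F , e with leaf-at-root F
                     (Unique-resp-↭ (vertices↭ e) (Unique-++ʳ (h ∷ cs) (distinct vl)))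
                     (∈-resp-↭ (leaves↭ e) x∈k)
  ...   | inj₁ refl = contradiction
            (subst (2 ≤_) (trans (cong length (++-identityʳ (ends k))) (↭-length (leaves↭ e))) two)
            λ { (s≤s ()) }
  ...   | inj₂ (a , b , refl) =
    let U , st , d , eq = close h cs link vl dom edges e in
    U , st , d , ≤-reflexive (trans eq (cong length (sym (++-identityʳ (ends k)))))

  -- `P` closes a cycle through `x` and `x′`. With three leaves there is a branching vertex below
  -- the root `x`, at which `unfold` cuts this cycle. The bound obtained is the number of ends below
  -- `x`, one less than the number of leaves.
  reconnect : ∀ {T x x′} P → Subtree T → Dominates (vertices T) → 3 ≤ length (leaves T) →
    x ∈ leaves T → x′ ∈ leaves T → x ≢ x′ →
    Linked (Adj G) (x ∷ P ++ x′ ∷ []) → VertexList P → (∀ {v} → v ∈ P → v ∉ vertices T) →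
    Smaller T _<_
  reconnect {T} {x} {x′} P st dom three x∈ x′∈ x≢x′ link vlP away
    with reroot T (leaves⊆vertices T x∈)
  ... | F , e with leaf-at-root F (distinct (vertexList (Subtree-resp-≈ e st))) (∈-resp-↭ (leaves↭ e) x∈)
  ...   | inj₁ refl = contradiction (subst (3 ≤_) (↭-length (leaves↭ e)) three) λ { (s≤s ()) }
  ...   | inj₂ (u , k , refl) =
    let U , st′ , d , le = unfold x P u k link (edge st₁ (here refl)) vl dom₁
                             (edge st₁ ∘ there ∘ there ∘ ∈-++⁺ˡ) x′∈k
                             (ℕ.≤-pred (subst (3 ≤_) (↭-length (leaves↭ e)) three))
    in record { tree = U ; subtree = st′ ; dominates = d
              ; fewer = subst (length (leaves U) <_) (sym (↭-length (leaves↭ e))) (s≤s le) }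
    where
    st₁ = Subtree-resp-≈ e st
    x′∈k : x′ ∈ ends (node u k nil)
    x′∈k = case ∈-resp-↭ (leaves↭ e) x′∈ of λ where
      (here x′≡x) → contradiction (sym x′≡x) x≢x′
      (there m)   → m
    same : P ++ vertices T ↭ x ∷ P ++ u ∷ verts k
    same = ↭-trans (++⁺ˡ P (vertices↭ e)) (↭-trans (shift x P _)
      (Perm.↭-reflexive (cong (λ xs → x ∷ P ++ u ∷ xs) (++-identityʳ (verts k)))))
    vl : VertexList (x ∷ P ++ u ∷ verts k)
    vl = VertexList-resp-↭ same (record
      { distinct = ++⁺-Unique (distinct vlP) (distinct (vertexList st)) (λ (m , m′) → away m m′)
      ; inGraph  = λ m → [ inGraph vlP , inGraph (vertexList st) ]′ (∈-++⁻ P m)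
      })
    dom₁ : Dominates (x ∷ P ++ u ∷ verts k)
    dom₁ = Dominates-⊆ (∈-resp-↭ same ∘ ∈-++⁺ʳ P) dom

  -- The edge from `w` to `a` is replaced by one from `x` to `a`. Then `x` is no longer a leaf, `a`
  -- keeps its degree, and `w` still has the neighbours `x` and `b`, so it does not become a leaf.
  swapEdge : ∀ {T x w a b} → Subtree T → Dominates (vertices T) → x ∈ leaves T →
    (w , x) ∈ arcs T → (w , a) ∈ arcs T → (w , b) ∈ arcs T → a ≢ x → b ≢ x → b ≢ a →
    Adj G x a → Smaller T _<_
  swapEdge {T} {x} {w} {a} {b} st dom x∈ wx wa wb a≢x b≢x b≢a xa
    with reroot T (arc⇒∈ _ _ wx)
  ... | F , e with distinct (vertexList (Subtree-resp-≈ e st))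
  ...   | uniq with front F (arc-root w F uniq (∈-resp-↭ (arcs↭ e) wx))
  ...     | kx , R₁ , F∼ with ∈-resp-↭ (roots-∼ F∼) (arc-root w F uniq (∈-resp-↭ (arcs↭ e) wa))
  ...       | here a≡x = contradiction a≡x a≢x
  ...       | there a∈ with front R₁ a∈
  -- Without further branches, `x` and `a` would be the only neighbours of `w`, which `b` rules out.
  ...         | ka , nil , R₁∼ = contradiction
                 (∈-resp-↭ (roots-∼ (∼-trans F∼ (∼-prep x kx R₁∼)))
                   (arc-root w F uniq (∈-resp-↭ (arcs↭ e) wb)))
                 λ { (here b≡x) → b≢x b≡x ; (there (here b≡a)) → b≢a b≡a }
  ...         | ka , R@(node _ _ _) , R₁∼ = finish kx refl
    where
    e₁ : ∀ {k} → k ≡ kx → T ≈ (w , node x k (node a ka R))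
    e₁ refl = ≈-trans e (siblings w (∼-trans F∼ (∼-prep x kx R₁∼)))
    finish : ∀ k → k ≡ kx → Smaller T _<_
    finish k@(node _ _ _) eq = contradiction
      (∈-resp-↭ (leaves↭ (e₁ eq)) x∈)
      (λ m → [ (λ m′ → Unique[x∷xs]⇒x∉xs u₁ (∈-++⁺ˡ (ends⊆verts k m′)))
             , (λ m′ → Unique[x∷xs]⇒x∉xs u₁ (∈-++⁺ʳ (verts k) (ends⊆verts (node a ka R) m′)))
             ]′ (∈-++⁻ (ends k) m))
      where
      u₁ : Unique (x ∷ verts k ++ verts (node a ka R))
      u₁ = case distinct (vertexList (Subtree-resp-≈ (e₁ eq) st)) of λ { (_ ∷ u) → u }
    finish nil eq = record
      { tree = U
      ; subtree = record { vertexList = VertexList-resp-↭ same (vertexList st₁) ; edge = edges }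
      ; dominates = Dominates-⊆ (∈-resp-↭ (↭-trans (vertices↭ (e₁ eq)) same)) dom
      ; fewer = ≤-reflexive (sym (trans (↭-length (leaves↭ (e₁ eq))) (cong (suc ∘ length) (ends-node a ka R))))
      }
      where
      st₁ = Subtree-resp-≈ (e₁ eq) st
      U = w , node x (node a ka nil) R
      same : w ∷ x ∷ a ∷ verts ka ++ verts R ↭ vertices U
      same = Perm.↭-reflexive (cong (λ xs → w ∷ x ∷ a ∷ xs ++ verts R) (sym (++-identityʳ (verts ka))))
      edges : ∀ {c d} → (c , d) ∈ arcs U → Adj G c d
      edges (here refl) = edge st₁ (here refl)
      edges (there (here refl)) = edge st₁ (there (here refl))
      edges (there (there (here refl))) = xa
      edges (there (there (there (here refl)))) = adj-sym G xa
      edges (there (there (there (there m)))) with ∈-++⁻ (arcsBelow a ka ++ []) m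
      ... | inj₁ m′ = edge st₁ (there (there (there (there
        (∈-++⁺ˡ (subst (_ ∈_) (++-identityʳ (arcsBelow a ka)) m′))))))
      ... | inj₂ m′ = edge st₁ (there (there (there (there (∈-++⁺ʳ (arcsBelow a ka) m′)))))

  -- Attaching vertices, and the existence of a dominating subtree.

  attach : ∀ {T s u} → Subtree T → s ∈ vertices T → u ∈ˢ V G → u ∉ vertices T → Adj G s u →
    ∃[ U ] Subtree U × vertices U ↭ u ∷ vertices T × arcs U ↭ (s , u) ∷ (u , s) ∷ arcs T
  attach {T} {s} {u} st s∈ u∈ u∉ su =
    let F , e = reroot T s∈
        same = ↭-trans (swap s u ↭-refl) (prep u (↭-sym (vertices↭ e)))
        same′ = prep (s , u) (prep (u , s) (↭-sym (arcs↭ e)))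
        edges : ∀ {a b} → (a , b) ∈ (s , u) ∷ (u , s) ∷ arcs T → Adj G a b
        edges = λ { (here refl) → su ; (there (here refl)) → adj-sym G su ; (there (there m)) → edge st m }
    in (s , node u nil F) ,
       record { vertexList = VertexList-resp-↭ (↭-sym same) (VertexList-∷ u∈ u∉ (vertexList st))
              ; edge = edges ∘ ∈-resp-↭ same′ } ,
       same , same′

  closed⇒reachable : ∀ {xs k u v} → (∀ {a b} → a ∈ xs → Adj G a b → b ∈ xs) → u ∈ xs → Walk G k u v → v ∈ xs
  closed⇒reachable {k = zero}  closed u∈ refl        = u∈
  closed⇒reachable {k = suc k} closed u∈ (w , uw , p) = closed⇒reachable closed (closed u∈ uw) p

  -- Vertices are attached until the vertex set is closed under adjacency; by connectedness it is
  -- then everything. `n` bounds the number of attachments, as the tree cannot exceed `N` vertices.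
  -- Only domination is recorded, since pruning does not preserve spanning.
  grow : Connected G → ∀ n T → Subtree T → N ≤ length (vertices T) + n →
    ∃[ U ] Subtree U × Dominates (vertices U)
  grow conn n T st size
    with Fin.any? (λ s → Fin.any? λ u → (s ∈ˡ? vertices T) ×-dec (adj? G s u) ×-dec ¬? (u ∈ˡ? vertices T))
  ... | no none = T , st , λ v∈ → inj₁ (closed⇒reachable closed (here refl)
          (proj₂ (proj₂ conn (inGraph (vertexList st) (here refl)) v∈)))
    where
    closed : ∀ {a b} → a ∈ vertices T → Adj G a b → b ∈ vertices T
    closed {a} {b} a∈ ab with b ∈ˡ? vertices T
    ... | yes b∈ = b∈
    ... | no b∉  = contradiction (a , b , a∈ , ab , b∉) none
  grow conn zero T st size | yes (s , u , s∈ , su , u∉) =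
    contradiction (Unique-⊆⇒length≤ (∉-Unique u∉ (distinct (vertexList st))) (λ _ → ∈-allFin _))
      (ℕ.<⇒≱ (s≤s (≤-trans (≤-reflexive (length-tabulate id)) (subst (N ≤_) (ℕ.+-identityʳ _) size))))
  grow conn (suc n) T st size | yes (s , u , s∈ , su , u∉) =
    let U , st′ , same , _ = attach st s∈ (adj⇒∈ G (adj-sym G su)) u∉ su
    in grow conn n U st′ (subst (N ≤_) (trans (ℕ.+-suc _ n) (cong (_+ n) (sym (↭-length same)))) size)

  dominatingTree : Connected G → ∃[ T ] Subtree T × Dominates (vertices T)
  dominatingTree conn@((v , v∈) , _) = grow conn N (v , nil)
    (record { vertexList = record { distinct = [] ∷ [] ; inGraph = λ { (here refl) → v∈ } } ; edge = λ () })
    (ℕ.m≤n+m N 1)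

  pendantArcs : (Fin N → Fin N) → List (Fin N) → List (Fin N × Fin N)
  pendantArcs h []       = []
  pendantArcs h (u ∷ us) = (h u , u) ∷ (u , h u) ∷ pendantArcs h us

  ∈-pendantArcs⁺ : ∀ h {us u} → u ∈ us → (u , h u) ∈ pendantArcs h us
  ∈-pendantArcs⁺ h (here refl) = there (here refl)
  ∈-pendantArcs⁺ h (there u∈)  = there (there (∈-pendantArcs⁺ h u∈))

  ∈-pendantArcs⁻ : ∀ h us {a b} → (a , b) ∈ pendantArcs h us → (b ∈ us × a ≡ h b) ⊎ (a ∈ us × b ≡ h a)
  ∈-pendantArcs⁻ h (u ∷ us) (here refl)         = inj₁ (here refl , refl)
  ∈-pendantArcs⁻ h (u ∷ us) (there (here refl)) = inj₂ (here refl , refl)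
  ∈-pendantArcs⁻ h (u ∷ us) (there (there m)) with ∈-pendantArcs⁻ h us m
  ... | inj₁ (b∈ , eq) = inj₁ (there b∈ , eq)
  ... | inj₂ (a∈ , eq) = inj₂ (there a∈ , eq)

  attachAll : ∀ {T} h us → Subtree T → VertexList us →
    (∀ {u} → u ∈ us → u ∉ vertices T × h u ∈ vertices T × Adj G u (h u)) →
    ∃[ U ] Subtree U × vertices U ↭ us ++ vertices T × arcs U ↭ pendantArcs h us ++ arcs T
  attachAll {T} h [] st vl hub = T , st , ↭-refl , ↭-refl
  attachAll {T} h (u ∷ us) st vl hub =
    let U , st₁ , same , same′ = attachAll h us st
          (record { distinct = AllPairs.tail (distinct vl) ; inGraph = inGraph vl ∘ there }) (hub ∘ there)
        u∉ , hu∈ , uhu = hub (here refl)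
        W , st₂ , same₂ , same₂′ = attach st₁ (∈-resp-↭ (↭-sym same) (∈-++⁺ʳ us hu∈)) (inGraph vl (here refl))
          (λ m → [ Unique[x∷xs]⇒x∉xs (distinct vl) , u∉ ]′ (∈-++⁻ us (∈-resp-↭ same m))) (adj-sym G uhu)
    in W , st₂ , ↭-trans same₂ (prep u same) , ↭-trans same₂′ (prep _ (prep _ same′))

  -- Spanning subtrees as connected acyclic graphs.

  walk-from-root : ∀ p F → (∀ {a b} → (a , b) ∈ arcsBelow p F → Adj G a b) →
    ∀ {v} → v ∈ p ∷ verts F → ∃[ k ] Walk G k p v
  walk-from-root p F edges (here refl) = 0 , refl
  walk-from-root p (node v k s) edges (there (here refl)) = 1 , v , edges (here refl) , refl
  walk-from-root p (node v k s) edges (there (there m)) with ∈-++⁻ (verts k) m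
  ... | inj₁ m′ =
    let n , w = walk-from-root v k (edges ∘ there ∘ there ∘ ∈-++⁺ˡ) (there m′)
    in suc n , v , edges (here refl) , w
  ... | inj₂ m′ = walk-from-root p s (edges ∘ there ∘ there ∘ ∈-++⁺ʳ (arcsBelow v k)) (there m′)

-- A walk in a tree that starts downwards and never backtracks goes down for
-- ever, so it does not return to the root.
no-return : ∀ {A : Set} {x u v : A} {F} → Unique (x ∷ verts F) → ∀ ws →
  Linked (λ a b → (a , b) ∈ arcsBelow x F) (v ∷ ws ++ x ∷ []) →
  Unique (u ∷ v ∷ ws) → x ∉ v ∷ ws → u ≢ x ⊎ ws ≢ [] → Below x F u v → ⊥
no-return {x = x} {u} {v} {F} uniq [] (vx ∷ _) uws x∉ back d with arc⇒Below x F vx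
... | inj₁ d′ = Unique[x∷xs]⇒x∉xs uniq (Below⇒∈ d′)
... | inj₂ d′ with back
...   | inj₁ u≢x = u≢x (Below-unique (AllPairs.tail uniq) d d′)
...   | inj₂ ne  = ne refl
no-return {x = x} {u} {v} {F} uniq (w ∷ ws) (vw ∷ link) uws@(u∉ ∷ uws′) x∉ back d with arc⇒Below x F vw
... | inj₁ d′ = no-return uniq ws link uws′ (x∉ ∘ there) (inj₁ λ { refl → x∉ (here refl) }) d′
... | inj₂ d′ = All.lookup u∉ (there (here refl)) (Below-unique (AllPairs.tail uniq) d d′)

module _ {N} (G : Graph N) {T : Tree (Fin N)} (st : Subtree G T)
  (spans : ∀ {v} → v ∈ˢ V G → v ∈ vertices T) where

  open DecMembership (≡-dec (Fin._≟_ {N}) (Fin._≟_ {N})) using () renaming (_∈?_ to _∈ᵃ?_)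

  treeGraph : Graph N
  treeGraph = record
    { V       = V G
    ; Adj     = λ u v → (u , v) ∈ arcs T
    ; adj?    = λ u v → (u , v) ∈ᵃ? arcs T
    ; adj-sym = arc-sym _ _
    ; adj-irr = adj-irr G ∘ edge st
    ; adj⇒∈   = adj⇒∈ G ∘ edge st
    }

  treeGraph-connected : Connected treeGraph
  treeGraph-connected = (_ , inGraph (vertexList st) (here refl)) , λ u∈ v∈ →
    let F , e = reroot T (spans u∈)
    in walk-from-root treeGraph _ F (∈-resp-↭ (↭-sym (arcs↭ e))) (∈-resp-↭ (vertices↭ e) (spans v∈))

  -- With the vertex `x` of the cycle as root, the first edge of the cycle leads downwards, and
  -- `no-return` applies to the rest.
  treeGraph-acyclic : ¬ Cycle treeGraph
  treeGraph-acyclic c with reroot T (arc⇒∈ _ _ (Linked.head (Cycle.edges c)))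
  ... | F , e with Cycle.edges c
  ...   | xy ∷ link =
    -- The cycle starts at the root itself, so its third vertex `z` is what excludes going straight
    -- back from `y` to `x`.
    no-return uniq (z ∷ ws) (Linked.map (∈-resp-↭ (arcs↭ e)) link) cyc (Unique[x∷xs]⇒x∉xs cyc)
      (inj₂ λ ()) below
    where
    open Cycle c using (x; y; z; ws) renaming (uniq to cyc)
    uniq = distinct (vertexList (Subtree-resp-≈ G e st))
    below : Below x F x y
    below with arc⇒Below x F (∈-resp-↭ (arcs↭ e) xy)
    ... | inj₁ d = d
    ... | inj₂ d = contradiction (Below⇒∈ d) (Unique[x∷xs]⇒x∉xs uniq)

  treeGraph-spanning : IsSpanningTree treeGraph G
  treeGraph-spanning = (treeGraph-connected , treeGraph-acyclic) , refl , edge st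

deg≡1⇒≡ : ∀ {N} (G : Graph N) {v a b} → deg G v ≡ 1 → Adj G v a → Adj G v b → a ≡ b
deg≡1⇒≡ G {v} {a} {b} one va vb with a Fin.≟ b
... | yes eq = eq
... | no a≢b = contradiction
  (length≤∣ ⟦ adj? G v ⟧ ∣ {a ∷ b ∷ []} ((a≢b ∷ []) ∷ [] ∷ [])
    λ { (here refl) → ∈⟦⟧⁺ (adj? G v) va ; (there (here refl)) → ∈⟦⟧⁺ (adj? G v) vb })
  (subst (λ n → ¬ 2 ≤ n) (sym one) λ { (s≤s ()) })

only⇒deg≡1 : ∀ {N} (G : Graph N) {v a} → Adj G v a → (∀ {b} → Adj G v b → b ≡ a) → deg G v ≡ 1
only⇒deg≡1 G {v} {a} va only = ℕ.≤-antisym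
  (∣ ⟦ adj? G v ⟧ ∣≤length {a ∷ []} λ b∈ → here (only (∈⟦⟧⁻ (adj? G v) b∈)))
  (length≤∣ ⟦ adj? G v ⟧ ∣ {a ∷ []} ([] ∷ []) λ { (here refl) → ∈⟦⟧⁺ (adj? G v) va })

inner-neighbours : ∀ {N} (G : Graph N) {S x} → Subtree G S → x ∈ vertices S → x ∉ leaves S →
  ∃₂ λ a b → a ≢ b × (x , a) ∈ arcs S × (x , b) ∈ arcs S
inner-neighbours G {S} {x} st x∈ x∉ with reroot S x∈
... | F , e with inner-at-root F (x∉ ∘ ∈-resp-↭ (↭-sym (leaves↭ e)))
...   | a , j , b , k , R , refl = a , b ,
        (λ { refl → case distinct (vertexList (Subtree-resp-≈ G e st)) of
               λ { (_ ∷ u) → Unique[x∷xs]⇒x∉xs u (∈-++⁺ʳ (verts j) (here refl)) } }) ,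
        ∈-resp-↭ (↭-sym (arcs↭ e)) (roots⇒arc x F (here refl)) ,
        ∈-resp-↭ (↭-sym (arcs↭ e)) (roots⇒arc x F (there (here refl)))

-- Completing a dominating subtree to a spanning tree.

module _ {N} (G : Graph N) {S : Tree (Fin N)} (st : Subtree G S) (dom : Dominates G (vertices S)) where

  open DecMembership (Fin._≟_ {N}) using () renaming (_∈?_ to _∈ˡ?_)

  hub? : ∀ u → Dec (∃[ s ] s ∈ vertices S × Adj G u s)
  hub? u = Fin.any? λ s → (s ∈ˡ? vertices S) ×-dec (adj? G u s)

  -- The default value `u` does not occur at a vertex of the graph outside `S`, which has a
  -- neighbour in `S` by domination.
  hub : Fin N → Fin N
  hub u with hub? u
  ... | yes (s , _) = s
  ... | no _        = u

  -- These are the vertices outside `S`. Each has a neighbour in `S` and becomes a pendant vertex of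
  -- the spanning tree.
  undominated : List (Fin N)
  undominated = filter (λ v → ¬? (v ∈ˡ? vertices S)) (elements (V G))

  hub-spec : ∀ {u} → u ∈ undominated → u ∉ vertices S × hub u ∈ vertices S × Adj G u (hub u)
  hub-spec {u} u∈ with ∈-filter⁻ (λ v → ¬? (v ∈ˡ? vertices S)) {xs = elements (V G)} u∈
  ... | u∈V , u∉ with hub? u
  ...   | yes (s , s∈ , us) = u∉ , s∈ , us
  ...   | no none = [ (λ u∈S → contradiction u∈S u∉) , (λ h → contradiction h none) ]′
                      (dom (∈-elements⁻ (V G) u∈V))

  extension : ∃[ U ] Subtree G U × vertices U ↭ undominated ++ vertices S ×
    arcs U ↭ pendantArcs G hub undominated ++ arcs S
  extension = attachAll G hub undominated st
    (record { distinct = filter⁺ (λ v → ¬? (v ∈ˡ? vertices S)) (elements-Unique (V G))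
            ; inGraph  = λ m → ∈-elements⁻ (V G) (proj₁ (∈-filter⁻ (λ v → ¬? (v ∈ˡ? vertices S)) m)) })
    hub-spec

  -- Vertices outside `S` are leaves of `H`, so the stem lies in `S`. If every leaf of `S` has a
  -- private neighbour, no vertex of `S` is a leaf of `H`; then a non-leaf of `S` keeps two
  -- neighbours in the stem.
  stemLeaves : Pruned G S → ∃[ T ] IsSpanningTree T G × ∣ Leaf (Stem T) ∣ ≤ length (leaves S)
  stemLeaves pruned = H , treeGraph-spanning G stU spans , ∣ Leaf (Stem H) ∣≤length (leaf∈ pruned)
    where
    U = proj₁ extension
    stU = proj₁ (proj₂ extension)
    vertsU = proj₁ (proj₂ (proj₂ extension))
    arcsU = proj₂ (proj₂ (proj₂ extension))
    new : ∀ {v} → v ∈ˢ V G → v ∉ vertices S → v ∈ undominated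
    new v∈ v∉ = ∈-filter⁺ (λ v → ¬? (v ∈ˡ? vertices S)) (∈-elements⁺ v∈) v∉
    spans : ∀ {v} → v ∈ˢ V G → v ∈ vertices U
    spans {v} v∈ with v ∈ˡ? vertices S
    ... | yes m = ∈-resp-↭ (↭-sym vertsU) (∈-++⁺ʳ undominated m)
    ... | no v∉ = ∈-resp-↭ (↭-sym vertsU) (∈-++⁺ˡ (new v∈ v∉))
    H = treeGraph G stU spans
    old : ∀ {a b} → (a , b) ∈ arcs S → Adj H a b
    old m = ∈-resp-↭ (↭-sym arcsU) (∈-++⁺ʳ (pendantArcs G hub undominated) m)
    pendant : ∀ {u} → u ∈ undominated → Adj H u (hub u)
    pendant u∈ = ∈-resp-↭ (↭-sym arcsU) (∈-++⁺ˡ (∈-pendantArcs⁺ G hub u∈))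
    pendant-only : ∀ {u b} → u ∈ undominated → Adj H u b → b ≡ hub u
    pendant-only {u} {b} u∈ ub with ∈-++⁻ (pendantArcs G hub undominated) (∈-resp-↭ arcsU ub)
    ... | inj₂ m = contradiction (arc⇒∈ _ _ m) (proj₁ (hub-spec u∈))
    ... | inj₁ m with ∈-pendantArcs⁻ G hub undominated m
    ...   | inj₂ (_ , eq) = eq
    ...   | inj₁ (b∈ , refl) = contradiction (proj₁ (proj₂ (hub-spec b∈))) (proj₁ (hub-spec u∈))
    Leaf⁺ : ∀ {v} → v ∈ˢ V G → deg H v ≡ 1 → v ∈ˢ Leaf H
    Leaf⁺ v∈ one = x∈p∩q⁺ (v∈ , ∈⟦⟧⁺ (λ v → deg H v ℕ.≟ 1) one)
    stem-inner : (∀ {x} → x ∈ leaves S → ∃[ y ] Private G S x y) →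
      ∀ {v x} → (v , x) ∈ arcs S → deg H x ≢ 1
    stem-inner priv {v} {x} vx one with x ∈ˡ? leaves S
    ... | no x∉ = let a , b , a≢b , xa , xb = inner-neighbours G st (arc⇒∈ _ _ (arc-sym _ _ vx)) x∉
                  in a≢b (deg≡1⇒≡ H one (old xa) (old xb))
    ... | yes x∈ with priv x∈
    ...   | y , y∈ , y∉ , yx , only =
      y∉ (subst (_∈ vertices S) (deg≡1⇒≡ H one (old (arc-sym _ _ vx)) (adj-sym H xy)) (arc⇒∈ _ _ vx))
      where
      -- A private neighbour can only be attached at its own leaf `x`, so `x` has a second neighbour
      -- in `H`.
      xy : Adj H y x
      xy = let _ , h∈ , yh = hub-spec (new y∈ y∉) in subst (Adj H y) (only _ h∈ yh) (pendant (new y∈ y∉))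
    leaf∈ : ∀ {v} → Pruned G S → v ∈ˢ Leaf (Stem H) → v ∈ leaves S
    leaf∈ {v} pruned v∈ with x∈p∩q⁻ (V (Stem H)) _ v∈
    ... | v∈Stem , v∈one with v ∈ˡ? vertices S
    ...   | no v∉S = contradiction
            (Leaf⁺ (p─q⊆p (V G) (Leaf H) v∈Stem) (only⇒deg≡1 H (pendant u∈) (pendant-only u∈)))
            (x∈p─q⇒x∉q (V G) v∈Stem)
      where u∈ = new (p─q⊆p (V G) (Leaf H) v∈Stem) v∉S
    ...   | yes v∈S with pruned | v ∈ˡ? leaves S
    ...     | _ | yes m = m
    ...     | inj₁ eq | no v∉ = nil⇒leaf S eq v∈S
    ...     | inj₂ priv | no v∉ =
      let a , b , a≢b , va , vb = inner-neighbours G st v∈S v∉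
          stem : ∀ {c} → (v , c) ∈ arcs S → Adj (Stem H) v c
          stem vc = old vc , x∈p─q⇒x∉q (V G) v∈Stem ,
            stem-inner priv vc ∘ ∈⟦⟧⁻ (λ v → deg H v ℕ.≟ 1) ∘ proj₂ ∘ x∈p∩q⁻ (V G) _
      in contradiction (deg≡1⇒≡ (Stem H) (∈⟦⟧⁻ (λ v → deg (Stem H) v ℕ.≟ 1) v∈one) (stem va) (stem vb)) a≢b

-- Reducing the number of leaves

starCopy : ∀ {N} (G : Graph N) {t w xs} → Unique xs → t ≤ length xs → (∀ {x} → x ∈ xs → Adj G w x) →
  (∀ {x y} → x ∈ xs → y ∈ xs → x ≢ y → ¬ Adj G x y) → w ∈ˢ V G → InducedCopy (Star t) G
starCopy {N} G {t} {w} {xs} u t≤ wx indep w∈ = record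
  { f = f ; f-V = λ {v} _ → f-V v ; f-inj = λ {a} {b} _ _ → f-inj a b
  ; f-adj = λ {a} {b} _ _ → mk⇔ (to a b) (from a b) }
  where
  g : Fin t → Fin N
  g i = lookup xs (Fin.inject≤ i t≤)
  g∈ : ∀ i → g i ∈ xs
  g∈ i = ∈-lookup (Fin.inject≤ i t≤)
  g-inj : ∀ i j → g i ≡ g j → i ≡ j
  g-inj i j eq = Fin.inject≤-injective t≤ t≤ i j (lookup-injective u _ _ eq)
  f : Fin (suc t) → Fin N
  f zero    = w
  f (suc i) = g i
  f-V : ∀ v → f v ∈ˢ V G
  f-V zero    = w∈
  f-V (suc i) = adj⇒∈ G (adj-sym G (wx (g∈ i)))
  f-inj : ∀ a b → f a ≡ f b → a ≡ b
  f-inj zero zero _ = refl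
  f-inj zero (suc j) eq = contradiction (subst (Adj G w) (sym eq) (wx (g∈ j))) (adj-irr G)
  f-inj (suc i) zero eq = contradiction (subst (Adj G w) eq (wx (g∈ i))) (adj-irr G)
  f-inj (suc i) (suc j) eq = cong suc (g-inj i j eq)
  to : ∀ a b → StarAdj a b → Adj G (f a) (f b)
  to _ _ (out {i}) = wx (g∈ i)
  to _ _ (inn {i}) = adj-sym G (wx (g∈ i))
  from : ∀ a b → Adj G (f a) (f b) → StarAdj a b
  from zero zero e = contradiction e (adj-irr G)
  from zero (suc j) e = out
  from (suc i) zero e = inn
  from (suc i) (suc j) e = contradiction e
    (indep (g∈ i) (g∈ j) λ eq → adj-irr G (subst (Adj G (g i)) (sym eq) e))

-- Distance at least 4, expressed by walks so that no minimum has to be evaluated.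
NoShortWalk : ∀ {N} → Graph N → Fin N → Fin N → Set
NoShortWalk G u v = ∀ k → k < 4 → ¬ Walk G k u v

-- `D` is the degree sum of `ys`. The closed neighbourhoods of the vertices of `ys` are pairwise
-- disjoint and miss `W`, so their sizes, each a degree plus one, and that of `W` add up to at most
-- the order of the graph.
σ⁴-bound : ∀ {N} (G : Graph N) {K ys W} → [ K ] ≤∞ σ 4 (length ys) G →
  VertexList G ys → (∀ {x y} → x ∈ ys → y ∈ ys → x ≢ y → NoShortWalk G x y) →
  VertexList G W → (∀ {y w} → y ∈ ys → w ∈ W → y ≢ w × ¬ Adj G y w) →
  ∃[ D ] K ≤ D × D + length ys + length W ≤ ∥ G ∥
σ⁴-bound {N} G {K} {ys} {W} K≤σ vl far vlW apart =
  degSum G Y , K≤ ,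
  ≤-trans (≤-trans (ℕ.+-monoˡ-≤ (length W) (ℕ.+-monoʳ-≤ (degSum G Y) ys≤zs)) (≤-reflexive (sym total)))
    (length≤∣ V G ∣ unique ⊆V)
  where
  open DecMembership (Fin._≟_ {N}) using () renaming (_∈?_ to _∈ˡ?_)
  Y = ⟦ _∈ˡ? ys ⟧
  -- The elements of `ys` in the order in which `degSum` sums over them.
  zs = filter (_∈? Y) (allFin N)
  zs⊆ys : ∀ {z} → z ∈ zs → z ∈ ys
  zs⊆ys m = ∈⟦⟧⁻ (_∈ˡ? ys) (proj₂ (∈-filter⁻ (_∈? Y) {xs = allFin N} m))
  ys≤zs : length ys ≤ length zs
  ys≤zs = Unique-⊆⇒length≤ (distinct vl) λ m → ∈-filter⁺ (_∈? Y) (∈-allFin _) (∈⟦⟧⁺ (_∈ˡ? ys) m)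
  admissible : Admissible 4 (length ys) G Y
  admissible = inGraph vl ∘ ∈⟦⟧⁻ (_∈ˡ? ys) ,
    ℕ.≤-antisym (∣ Y ∣≤length (∈⟦⟧⁻ (_∈ˡ? ys))) (length≤∣ Y ∣ (distinct vl) (∈⟦⟧⁺ (_∈ˡ? ys))) ,
    λ x y x∈ y∈ x≢y → ≤dist G (far (∈⟦⟧⁻ (_∈ˡ? ys) x∈) (∈⟦⟧⁻ (_∈ˡ? ys) y∈) x≢y)
  K≤ : K ≤ degSum G Y
  K≤ = [≤]-injective _≤_ (≤⁺-trans _≤_ ≤-trans K≤σ (σ≤ G admissible))
  ball : Fin N → List (Fin N)
  ball z = z ∷ elements ⟦ adj? G z ⟧
  ∈ball : ∀ {z v} → v ∈ ball z → z ≡ v ⊎ Adj G z v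
  ∈ball (here refl) = inj₁ refl
  ∈ball {z} (there m) = inj₂ (∈⟦⟧⁻ (adj? G z) (∈-elements⁻ ⟦ adj? G z ⟧ m))
  total : length (concatMap ball zs ++ W) ≡ degSum G Y + length zs + length W
  total = trans (length-++ (concatMap ball zs)) (cong (_+ length W)
    (length-concatMap-suc ball (deg G) zs λ z → cong suc (length-elements ⟦ adj? G z ⟧)))
  ball-Unique : ∀ {z} → z ∈ zs → Unique (ball z)
  ball-Unique {z} _ = ∉-Unique (λ m → adj-irr G (∈⟦⟧⁻ (adj? G z) (∈-elements⁻ ⟦ adj? G z ⟧ m)))
                        (elements-Unique ⟦ adj? G z ⟧)
  ball-disjoint : ∀ {x y z} → x ∈ zs → y ∈ zs → x ≢ y → z ∈ ball x → z ∈ ball y → ⊥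
  ball-disjoint {x} {y} x∈ y∈ x≢y zx zy with ∈ball zx | ∈ball zy | far (zs⊆ys x∈) (zs⊆ys y∈) x≢y
  ... | inj₁ refl | inj₁ refl | no-walk = x≢y refl
  ... | inj₁ refl | inj₂ yx   | no-walk = no-walk 1 (s≤s (s≤s z≤n)) (y , adj-sym G yx , refl)
  ... | inj₂ xy   | inj₁ refl | no-walk = no-walk 1 (s≤s (s≤s z≤n)) (y , xy , refl)
  ... | inj₂ xz   | inj₂ yz   | no-walk = no-walk 2 (s≤s (s≤s (s≤s z≤n))) (_ , xz , y , adj-sym G yz , refl)
  in-some-ball : ∀ {v} → v ∈ concatMap ball zs → ∃[ y ] y ∈ ys × (y ≡ v ⊎ Adj G y v)
  in-some-ball m = let z , z∈ , m′ = find (∈-concatMap⁻ ball {zs} m) in z , zs⊆ys z∈ , ∈ball m′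
  unique : Unique (concatMap ball zs ++ W)
  unique = ++⁺-Unique
    (concatMap-Unique ball (filter⁺ (_∈? Y) (allFin⁺ N)) ball-Unique ball-disjoint) (distinct vlW)
    λ (m , w∈) → let y , y∈ , near = in-some-ball m in
      [ proj₁ (apart y∈ w∈) , proj₂ (apart y∈ w∈) ]′ near
  ⊆V : ∀ {v} → v ∈ concatMap ball zs ++ W → v ∈ˢ V G
  ⊆V m with ∈-++⁻ (concatMap ball zs) m
  ... | inj₂ w∈ = inGraph vlW w∈
  ... | inj₁ b∈ with in-some-ball b∈
  ...   | y , y∈ , inj₁ refl = inGraph vl y∈
  ...   | y , y∈ , inj₂ yv   = adj⇒∈ G (adj-sym G yv)

-- Paths between leaves through their private neighbours.

module _ {N} (G : Graph N) where

  Connector : Tree (Fin N) → Fin N → Fin N → Set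
  Connector T x x′ = ∃[ P ] Linked (Adj G) (x ∷ P ++ x′ ∷ []) × VertexList G P ×
    (∀ {v} → v ∈ P → v ∉ vertices T)

  -- A neighbour of `y` in the tree can only be `x`, and one of `y′` only `x′`. So if an inner
  -- vertex of a walk of length 3 lies in the tree, the path starts or ends there; otherwise it runs
  -- from `x` through the walk to `x′`.
  connect : ∀ {T x x′ y y′} → x ∈ vertices T → x′ ∈ vertices T → x ≢ x′ →
    Private G T x y → Private G T x′ y′ → ∀ k → k < 4 → Walk G k y y′ → Connector T x x′
  connect {T} {x} {x′} {y} {y′} x∈ x′∈ x≢x′ (y∈ , y∉ , yx , only) (y′∈ , y′∉ , y′x′ , only′) = go
    where
    open DecMembership (Fin._≟_ {N}) using () renaming (_∈?_ to _∈ˡ?_)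
    y≢y′ : y ≢ y′
    y≢y′ refl = x≢x′ (only′ x x∈ yx)
    ≢-adj : ∀ {u v} → Adj G u v → u ≢ v
    ≢-adj e refl = adj-irr G e
    empty : VertexList G []
    empty = record { distinct = [] ; inGraph = λ () }
    direct : Adj G y y′ → Connector T x x′
    direct e = y ∷ y′ ∷ [] , adj-sym G yx ∷ e ∷ y′x′ ∷ [-] ,
      VertexList-∷ G y∈ (λ { (here eq) → y≢y′ eq }) (VertexList-∷ G y′∈ (λ ()) empty) ,
      λ { (here refl) → y∉ ; (there (here refl)) → y′∉ }
    go : ∀ k → k < 4 → Walk G k y y′ → Connector T x x′
    go 0 _ eq = contradiction eq y≢y′
    go 1 _ (_ , yy′ , refl) = direct yy′
    go 2 _ (a , ya , _ , ay′ , refl) with a ∈ˡ? vertices T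
    ... | yes a∈ = contradiction (trans (sym (only a a∈ ya)) (only′ a a∈ (adj-sym G ay′))) x≢x′
    ... | no a∉  = y ∷ a ∷ y′ ∷ [] , adj-sym G yx ∷ ya ∷ ay′ ∷ y′x′ ∷ [-] ,
      VertexList-∷ G y∈ (λ { (here eq) → ≢-adj ya eq ; (there (here eq)) → y≢y′ eq })
        (VertexList-∷ G (adj⇒∈ G ay′) (λ { (here eq) → ≢-adj ay′ eq }) (VertexList-∷ G y′∈ (λ ()) empty)) ,
      λ { (here refl) → y∉ ; (there (here refl)) → a∉ ; (there (there (here refl))) → y′∉ }
    go 3 _ (a , ya , b , ab , _ , by′ , refl) with a ∈ˡ? vertices T | b ∈ˡ? vertices T
    ... | yes a∈ | yes b∈ rewrite only a a∈ ya | only′ b b∈ (adj-sym G by′) =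
      [] , ab ∷ [-] , empty , λ ()
    ... | yes a∈ | no b∉ rewrite only a a∈ ya =
      b ∷ y′ ∷ [] , ab ∷ by′ ∷ y′x′ ∷ [-] ,
      VertexList-∷ G (adj⇒∈ G by′) (λ { (here eq) → ≢-adj by′ eq }) (VertexList-∷ G y′∈ (λ ()) empty) ,
      λ { (here refl) → b∉ ; (there (here refl)) → y′∉ }
    ... | no a∉ | yes b∈ rewrite only′ b b∈ (adj-sym G by′) =
      y ∷ a ∷ [] , adj-sym G yx ∷ ya ∷ ab ∷ [-] ,
      VertexList-∷ G y∈ (λ { (here eq) → ≢-adj ya eq }) (VertexList-∷ G (adj⇒∈ G ab) (λ ()) empty) ,
      λ { (here refl) → y∉ ; (there (here refl)) → a∉ }
    -- If the walk repeats a vertex, `y` and `y′` are adjacent.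
    ... | no a∉ | no b∉ with y Fin.≟ b | a Fin.≟ y′
    ...   | yes refl | _ = direct by′
    ...   | no _ | yes refl = direct ya
    ...   | no y≢b | no a≢y′ = y ∷ a ∷ b ∷ y′ ∷ [] , adj-sym G yx ∷ ya ∷ ab ∷ by′ ∷ y′x′ ∷ [-] ,
      VertexList-∷ G y∈ (λ { (here eq) → ≢-adj ya eq ; (there (here eq)) → y≢b eq
                       ; (there (there (here eq))) → y≢y′ eq })
        (VertexList-∷ G (adj⇒∈ G ab) (λ { (here eq) → ≢-adj ab eq ; (there (here eq)) → a≢y′ eq })
          (VertexList-∷ G (adj⇒∈ G by′) (λ { (here eq) → ≢-adj by′ eq }) (VertexList-∷ G y′∈ (λ ()) empty))) ,
      λ { (here refl) → y∉ ; (there (here refl)) → a∉ ; (there (there (here refl))) → b∉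
        ; (there (there (there (here refl)))) → y′∉ }
    go (suc (suc (suc (suc k)))) (s≤s (s≤s (s≤s (s≤s ()))))

-- After cancellation, l + w ≤ l (c + 2) / (c + 1) is (l + w) (c + 1) ≤ l (c + 1) + l.
interior-bound : ∀ n c l w {D} → n ∸ (l * (2 + c)) / (1 + c) ∸ 1 ≤ D → D + suc l + w ≤ n → w * (1 + c) ≤ l
interior-bound n c l w {D} K≤D total = ℕ.+-cancelˡ-≤ (l * (1 + c)) _ _ (begin
  l * (1 + c) + w * (1 + c) ≡⟨ sym (ℕ.*-distribʳ-+ (1 + c) l w) ⟩
  (l + w) * (1 + c)         ≤⟨ ℕ.*-monoˡ-≤ (1 + c) (ℕ.+-cancelˡ-≤ (suc D) _ _ l+w≤f) ⟩
  f * (1 + c)               ≤⟨ m/n*n≤m (l * (2 + c)) (1 + c) ⟩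
  l * (2 + c)               ≡⟨ ℕ.*-suc l (1 + c) ⟩
  l + l * (1 + c)           ≡⟨ ℕ.+-comm l _ ⟩
  l * (1 + c) + l           ∎)
  where
  open ℕ.≤-Reasoning
  f = (l * (2 + c)) / (1 + c)
  l+w≤f : suc D + (l + w) ≤ suc D + f
  l+w≤f = begin
    suc D + (l + w)           ≡⟨ cong suc (sym (ℕ.+-assoc D l w)) ⟩
    suc (D + l) + w           ≡⟨ cong (_+ w) (sym (ℕ.+-suc D l)) ⟩
    D + suc l + w             ≤⟨ total ⟩
    -- Truncation of the subtractions does no harm, since only upper bounds for `n` are needed.
    n                         ≤⟨ ℕ.m≤n+m∸n n f ⟩
    f + (n ∸ f)               ≤⟨ ℕ.+-monoʳ-≤ f (ℕ.m≤n+m∸n (n ∸ f) 1) ⟩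
    f + (1 + (n ∸ f ∸ 1))     ≤⟨ ℕ.+-monoʳ-≤ f (s≤s K≤D) ⟩
    f + suc D                 ≡⟨ ℕ.+-comm f (suc D) ⟩
    suc D + f                 ∎

-- The reduction step for a tree with private neighbours and more than `l` leaves, where `t` is
-- `3 + c`.

module _ {N} (G : Graph N) {c l} (2≤l : 2 ≤ l) (l≢ : l ≢ suc c) (star-free : StarFree (3 + c) G)
  (bound : [ ∥ G ∥ ∸ (l * (2 + c)) / (1 + c) ∸ 1 ] ≤∞ σ 4 (suc l) G)
  {S : Tree (Fin N)} (st : Subtree G S) (dom : Dominates G (vertices S))
  (priv : ∀ {x} → x ∈ leaves S → ∃[ y ] Private G S x y) (many : l < length (leaves S)) where

  private
    open DecMembership (Fin._≟_ {N}) using () renaming (_∈?_ to _∈ˡ?_)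
    open DecMembership (≡-dec (Fin._≟_ {N}) (Fin._≟_ {N})) using () renaming (_∈?_ to _∈ᵃ?_)

    three : 3 ≤ length (leaves S)
    three = ≤-trans (s≤s 2≤l) many

    leaf∈S : ∀ {x} → x ∈ leaves S → x ∈ vertices S
    leaf∈S = leaves⊆vertices S

    -- The default value `x` does not occur at leaves of `S`, by `priv`.
    partner : Fin N → Fin N
    partner x with Fin.any? (private? G S x)
    ... | yes (y , _) = y
    ... | no _        = x

    partner-private : ∀ {x} → x ∈ leaves S → Private G S x (partner x)
    partner-private {x} x∈ with Fin.any? (private? G S x)
    ... | yes (_ , p) = p
    ... | no none     = contradiction (priv x∈) none

    interior : List (Fin N)
    interior = filter (λ v → ¬? (v ∈ˡ? leaves S)) (vertices S)

    interior⁻ : ∀ {w} → w ∈ interior → w ∈ vertices S × w ∉ leaves S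
    interior⁻ = ∈-filter⁻ (λ v → ¬? (v ∈ˡ? leaves S)) {xs = vertices S}

    interior⁺ : ∀ {w} → w ∈ vertices S → w ∉ leaves S → w ∈ interior
    interior⁺ = ∈-filter⁺ (λ v → ¬? (v ∈ˡ? leaves S))

    distinctLeaves : Unique (leaves S)
    distinctLeaves = leaves-Unique S (distinct (vertexList st))

    Close : Fin N → Fin N → Fin 4 → Set
    Close x x′ k = x ∈ leaves S × x′ ∈ leaves S × x ≢ x′ × Walk G (toℕ k) (partner x) (partner x′)

    close? : Dec (∃[ x ] ∃[ x′ ] ∃[ k ] Close x x′ k)
    close? = Fin.any? λ x → Fin.any? λ x′ → Fin.any? λ k →
      (x ∈ˡ? leaves S) ×-dec (x′ ∈ˡ? leaves S) ×-dec (¬? (x Fin.≟ x′)) ×-dec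
      walk? G (toℕ k) (partner x) (partner x′)

    -- The case of private neighbours pairwise at distance at least 4.

    module Apart (apart : ∀ {x x′} → x ∈ leaves S → x′ ∈ leaves S → x ≢ x′ →
      NoShortWalk G (partner x) (partner x′)) where

      -- Adjacent leaves would give a walk of length 3 between their partners.
      leaves-independent : ∀ {x x′} → x ∈ leaves S → x′ ∈ leaves S → x ≢ x′ → ¬ Adj G x x′
      leaves-independent x∈ x′∈ x≢x′ xx′ =
        let _ , _ , yx , _ = partner-private x∈
            _ , _ , y′x′ , _ = partner-private x′∈
        in apart x∈ x′∈ x≢x′ 3 ≤-refl (_ , yx , _ , xx′ , _ , adj-sym G y′x′ , refl)

      -- The degree condition is applied to the partners of `suc l` leaves. The only neighbour of a
      -- partner in `S` is its leaf, so its closed neighbourhood misses the interior.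
      few-interior : length interior * (1 + c) ≤ l
      few-interior =
        let D , K≤D , total = σ⁴-bound G {ys = ys} {W = interior}
              (subst (λ p → _ ≤∞ σ 4 p G) (sym length-ys) bound) vl far
              (record { distinct = filter⁺ (λ v → ¬? (v ∈ˡ? leaves S)) (distinct (vertexList st))
                      ; inGraph  = inGraph (vertexList st) ∘ proj₁ ∘ interior⁻ })
              away
        in interior-bound ∥ G ∥ c l (length interior) K≤D
             (subst (λ p → D + p + length interior ≤ ∥ G ∥) length-ys total)
        where
        xs = take (suc l) (leaves S)
        ys = map partner xs
        xs⊆ : ∀ {x} → x ∈ xs → x ∈ leaves S
        xs⊆ {x} m = subst (x ∈_) (take++drop≡id (suc l) (leaves S)) (∈-++⁺ˡ m)
        length-ys : length ys ≡ suc l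
        length-ys = trans (length-map partner xs) (trans (length-take (suc l) (leaves S)) (ℕ.m≤n⇒m⊓n≡m many))
        injective : ∀ {x x′} → x ∈ leaves S → x′ ∈ leaves S → partner x ≡ partner x′ → x ≡ x′
        injective x∈ x′∈ eq =
          let _ , _ , yx , _ = partner-private x∈
              _ , _ , _ , only = partner-private x′∈
          in only _ (leaf∈S x∈) (subst (λ y → Adj G y _) eq yx)
        vl : VertexList G ys
        vl = record
          { distinct = map-Unique partner (take⁺ (suc l) distinctLeaves) (λ m m′ → injective (xs⊆ m) (xs⊆ m′))
          ; inGraph  = λ m → let x , x∈ , eq = ∈-map⁻ partner m in
              subst (_∈ˢ V G) (sym eq) (proj₁ (partner-private (xs⊆ x∈)))
          }
        far : ∀ {y y′} → y ∈ ys → y′ ∈ ys → y ≢ y′ → NoShortWalk G y y′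
        far m m′ y≢y′ with ∈-map⁻ partner m | ∈-map⁻ partner m′
        ... | x , x∈ , refl | x′ , x′∈ , refl = apart (xs⊆ x∈) (xs⊆ x′∈) λ { refl → y≢y′ refl }
        away : ∀ {y w} → y ∈ ys → w ∈ interior → y ≢ w × ¬ Adj G y w
        away m w∈ with ∈-map⁻ partner m
        ... | x , x∈ , refl =
          let w∈S , w∉ = interior⁻ w∈
              _ , y∉ , _ , only = partner-private (xs⊆ x∈)
          in (λ eq → y∉ (subst (_∈ vertices S) (sym eq) w∈S)) ,
             λ yw → w∉ (subst (_∈ leaves S) (sym (only _ w∈S yw)) (xs⊆ x∈))

      around : Fin N → List (Fin N)
      around w = filter (λ x → (w , x) ∈ᵃ? arcs S) (leaves S)

      around⁻ : ∀ {w x} → x ∈ around w → x ∈ leaves S × (w , x) ∈ arcs S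
      around⁻ {w} = ∈-filter⁻ (λ x → (w , x) ∈ᵃ? arcs S) {xs = leaves S}

      around-Unique : ∀ w → Unique (around w)
      around-Unique w = filter⁺ (λ x → (w , x) ∈ᵃ? arcs S) distinctLeaves

      -- Every leaf has an interior neighbour. With at most `suc c` leaves around each interior
      -- vertex there would be at most `l` leaves, by `few-interior`.
      crowded : ∃[ w ] w ∈ interior × suc c < length (around w)
      crowded = pigeonhole {R = λ w x → (w , x) ∈ arcs S} (λ w x → (w , x) ∈ᵃ? arcs S)
        (suc c) interior distinctLeaves
        (λ x∈ → let w , w∉ , wx = leafNeighbour (distinct (vertexList st)) three x∈
                in w , interior⁺ (arc⇒∈ _ _ wx) w∉ , wx)
        (ℕ.≤-<-trans few-interior many)

      -- Otherwise S is a star with centre w, so that l ≤ c + 1 by K(1,c+3)-freeness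
      -- and c + 1 ≤ l by few-interior.
      outer-neighbour : ∀ {w} → w ∈ interior → ¬ (∀ a → (w , a) ∈ arcs S → a ∈ leaves S)
      outer-neighbour {w} w∈ all with 3 + c ℕ.≤? length (leaves S)
      ... | yes t≤ = star-free (starCopy G distinctLeaves t≤
              (λ x∈ → edge st (leaves-around (distinct (vertexList st)) (proj₁ (interior⁻ w∈))
                        (proj₂ (interior⁻ w∈)) (all _) x∈))
              leaves-independent (inGraph (vertexList st) (proj₁ (interior⁻ w∈))))
      ... | no t≰ = l≢ (ℕ.≤-antisym (ℕ.≤-pred (≤-trans many (ℕ.≤-pred (ℕ.≰⇒> t≰))))
              (≤-trans (ℕ.m≤n*m (suc c) (length interior) {{>-nonZero (∈-length w∈)}}) few-interior))

      swap-possible : Smaller G S _<_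
      swap-possible with crowded
      ... | w , w∈ , c< with Fin.any? (λ a → ((w , a) ∈ᵃ? arcs S) ×-dec ¬? (a ∈ˡ? leaves S))
      ...   | no none = contradiction all (outer-neighbour w∈)
        where
        all : ∀ a → (w , a) ∈ arcs S → a ∈ leaves S
        all a wa with a ∈ˡ? leaves S
        ... | yes a∈ = a∈
        ... | no a∉  = contradiction (a , wa , a∉) none
      ...   | yes (a , wa , a∉) with Any.any? (adj? G a) (around w)
      -- The vertex `a` and the leaves around `w` are then independent: at least `c + 3` neighbours
      -- of `w`.
      ...     | no none = contradiction
                (starCopy G (∉-Unique (a∉ ∘ proj₁ ∘ around⁻) (around-Unique w)) (s≤s c<)
                  (λ { (here refl) → edge st wa ; (there m) → edge st (proj₂ (around⁻ m)) })
                  indep (inGraph (vertexList st) (proj₁ (interior⁻ w∈))))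
                star-free
        where
        indep : ∀ {x y} → x ∈ a ∷ around w → y ∈ a ∷ around w → x ≢ y → ¬ Adj G x y
        indep (here refl) (here refl) x≢y _  = x≢y refl
        indep (here refl) (there m)   _   xy = none (lose m xy)
        indep (there m)   (here refl) _   xy = none (lose m (adj-sym G xy))
        indep (there m)   (there m′)         = leaves-independent (proj₁ (around⁻ m)) (proj₁ (around⁻ m′))
      ...     | yes found with find found
      -- A second leaf `b` at `w` serves as the neighbour that `w` keeps besides `x`.
      ...       | x , x∈ , ax with another (around-Unique w) (≤-trans (s≤s (s≤s z≤n)) c<) x
      ...         | b , b∈ , b≢x =
        swapEdge G st dom (proj₁ (around⁻ x∈)) (proj₂ (around⁻ x∈)) wa (proj₂ (around⁻ b∈))
          (λ { refl → a∉ (proj₁ (around⁻ x∈)) }) b≢x (λ { refl → a∉ (proj₁ (around⁻ b∈)) }) (adj-sym G ax)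

  improve : Smaller G S _<_
  improve with close?
  ... | yes (x , x′ , k , x∈ , x′∈ , x≢x′ , walk) =
    let P , link , vl , away = connect G (leaf∈S x∈) (leaf∈S x′∈) x≢x′
                                 (partner-private x∈) (partner-private x′∈) (toℕ k) (Fin.toℕ<n k) walk
    in reconnect G P st dom three x∈ x′∈ x≢x′ link vl away
  ... | no none = Apart.swap-possible λ {x} {x′} x∈ x′∈ x≢x′ k k< walk →
    none (x , x′ , Fin.fromℕ< k< , x∈ , x′∈ , x≢x′ ,
      subst (λ j → Walk G j _ _) (sym (Fin.toℕ-fromℕ< k<)) walk)

-- Induction on `n`, a bound for the number of leaves: pruning does not raise this number, and
-- `improve` lowers it as long as it exceeds `l`.
boundedStem : ∀ {N} (G : Graph N) {c l} → 2 ≤ l → l ≢ suc c → StarFree (3 + c) G →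
  [ ∥ G ∥ ∸ (l * (2 + c)) / (1 + c) ∸ 1 ] ≤∞ σ 4 (suc l) G →
  ∀ n T → length (leaves T) ≤ n → Subtree G T → Dominates G (vertices T) →
  ∃[ H ] IsSpanningTree H G × ∣ Leaf (Stem H) ∣ ≤ l
boundedStem G {c} {l} 2≤l l≢ free bound n T m≤n st dom with prune G (length (vertices T)) T ≤-refl st dom
... | s , pruned with length (leaves (tree s)) ℕ.≤? l
...   | yes m≤l = let H , span , stem = stemLeaves G (subtree s) (dominates s) pruned
                in H , span , ≤-trans stem m≤l
...   | no m≰l with pruned
...     | inj₁ eq = contradiction (≤-trans (≤-reflexive (one (tree s) eq)) (≤-trans (s≤s z≤n) 2≤l)) m≰l
  where
  one : ∀ {A : Set} (T : Tree A) → proj₂ T ≡ nil → length (leaves T) ≡ 1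
  one (p , nil) refl = refl
...     | inj₂ priv with n
...       | zero = contradiction (≤-trans (≤-trans (fewer s) m≤n) z≤n) m≰l
...       | suc n′ =
  let r = improve G 2≤l l≢ free bound (subtree s) (dominates s) priv (ℕ.≰⇒> m≰l)
  in boundedStem G 2≤l l≢ free bound n′ (tree r) (ℕ.≤-pred (≤-trans (fewer r) (≤-trans (fewer s) m≤n)))
       (subtree r) (dominates r)

theorem1p6 : ∀ {N} (t l : ℕ) (3≤t : 3 ≤ t) → 2 ≤ l → l ≢ t ∸ 2 →
    (G : Graph N) → Connected G → StarFree t G →
    [ ∥ G ∥ ∸ ((l * (t ∸ 1)) / (t ∸ 2)) {{∸-nonZero 3≤t}} ∸ 1 ] ≤∞ σ 4 (l + 1) G →
    ∃[ T ] IsSpanningTree T G × ∣ Leaf (Stem T) ∣ ≤ l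
-- With `t` in the form `3 + c`, the terms `t ∸ 1` and `t ∸ 2` evaluate to `2 + c` and `1 + c`.
theorem1p6 (suc (suc (suc c))) l (s≤s (s≤s (s≤s z≤n))) 2≤l l≢ G conn free bound =
  let T , st , dom = dominatingTree G conn
  in boundedStem G 2≤l l≢ free (subst (λ p → K ≤∞ σ 4 p G) (ℕ.+-comm l 1) bound)
       (length (leaves T)) T ≤-refl st dom
  where
  K = [ ∥ G ∥ ∸ (l * (2 + c)) / (1 + c) ∸ 1 ]
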